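{- There is an absolute constant $C$ such that for all positive integers $k$ and $t$, every $(k+1)$-connected finite simple graph $G$ that does not contain $k$ pairwise vertex-disjoint cycles each of length at least $t$ has pathwidth at most $C(t^3+tk^2)$.
   Context: A path decomposition of $G$ is a sequence $(B_1,\dots,B_n)$ of subsets of $V(G)$ such that every vertex lies in some bag, for each vertex $v$ the set of indices $i$ with $v\in B_i$ is an interval, and every edge has both endpoints in some common bag; its width is $\max_i |B_i|-1$. The pathwidth of $G$ is the minimum width of a path decomposition of $G$. -}

module Defs where

open import Data.Nat using (ℕ; zero; suc; _+_; _*_; _∸_; _^_; _≤_; _<_; _⊔_)
open import Data.Bool using (Bool; true; false; T)
open import Data.Fin using (Fin)
open import Data.Fin.Subset using (Subset; _∈_; _∉_; ∣_∣)
open import Data.List using (List; []; _∷_; length; _∷ʳ_)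
open import Data.List.Relation.Unary.Unique.Propositional using (Unique)
open import Data.List.Relation.Unary.Linked using (Linked)
import Data.List.Membership.Propositional as LM
open import Data.Vec.Functional using () renaming (foldr to vfoldr)
open import Data.Product using (Σ; _×_; _,_)
open import Relation.Binary.PropositionalEquality using (_≡_; _≢_)
open import Relation.Nullary using (¬_)

record Graph (n : ℕ) : Set where
  field
    adj   : Fin n → Fin n → Bool
    sym   : ∀ u v → adj u v ≡ adj v u
    irrefl : ∀ v → adj v v ≡ false

open Graph public

Adj : ∀ {n} → Graph n → Fin n → Fin n → Set
Adj G u v = T (adj G u v)

-- Reach G X u v : there is a walk from u to v in G - X (u assumed outside X).
data Reach {n} (G : Graph n) (X : Subset n) : Fin n → Fin n → Set where
  here : ∀ {u} → Reach G X u u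
  step : ∀ {u w v} → Adj G u w → w ∉ X → Reach G X w v → Reach G X u v

ConnectedWithout : ∀ {n} → Graph n → Subset n → Set
ConnectedWithout {n} G X = ∀ (u v : Fin n) → u ∉ X → v ∉ X → Reach G X u v

-- G is c-connected (Diestel): |G| > c and G - X is connected for every X with |X| < c.
KConnected : ℕ → ∀ {n} → Graph n → Set
KConnected c {n} G = (c < n) × (∀ (X : Subset n) → ∣ X ∣ < c → ConnectedWithout G X)

record Cycle {n} (G : Graph n) : Set where
  field
    start  : Fin n
    rest   : List (Fin n)
    long   : 2 ≤ length rest
    unique : Unique (start ∷ rest)
    closed : Linked (Adj G) ((start ∷ rest) ∷ʳ start)

open Cycle public

cycleVertices : ∀ {n} {G : Graph n} → Cycle G → List (Fin n)
cycleVertices C = start C ∷ rest C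

cycleLength : ∀ {n} {G : Graph n} → Cycle G → ℕ
cycleLength C = length (cycleVertices C)

HasDisjointLongCycles : ∀ {n} → Graph n → (k t : ℕ) → Set
HasDisjointLongCycles G k t =
  Σ (Fin k → Cycle G) λ cs →
    (∀ i → t ≤ cycleLength (cs i)) ×
    (∀ i j → i ≢ j → ∀ x → x LM.∈ cycleVertices (cs i) → ¬ (x LM.∈ cycleVertices (cs j)))

record PathDecomposition {n} (G : Graph n) : Set where
  field
    m        : ℕ
    bag      : Fin m → Subset n
    covers   : ∀ (v : Fin n) → Σ (Fin m) λ i → v ∈ bag i
    interval : ∀ (v : Fin n) (i j l : Fin m) →
               Data.Fin._≤_ i j → Data.Fin._≤_ j l → v ∈ bag i → v ∈ bag l → v ∈ bag j
    edges    : ∀ (u v : Fin n) → Adj G u v → Σ (Fin m) λ i → (u ∈ bag i) × (v ∈ bag i)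

open PathDecomposition public

width : ∀ {n} {G : Graph n} → PathDecomposition G → ℕ
width D = vfoldr _⊔_ 0 (λ i → ∣ bag D i ∣ ∸ 1)

PathwidthAtMost : ∀ {n} → Graph n → ℕ → Set
PathwidthAtMost G w = Σ (PathDecomposition G) λ D → width D ≤ w

{-# OPTIONS --safe #-}

-- Call a cycle long if it has at least t vertices.  Let B be the union of a maximal family of fewer than k disjoint
-- long cycles, listed along these cycles; G ∖ B has no long cycle, so in a depth-first search of it every subtree
-- touches fewer than t of its ancestors.  Going up the search trees, cut off each remaining subtree that joins two
-- places of B far apart or has long cycles through k different vertices of B, by deleting its root, the ancestors it
-- touches and, in the first case, the 2t vertices of B around either place.  Subtrees of the second kind give
-- disjoint long cycles greedily, so there are fewer than k of them.  Those of the first kind are ears of B; after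
-- cutting B into O(k) intervals with O(k) ear ends each, the pigeonhole principle finds, among sufficiently many
-- (O(k²)) ears, two with the same pair of intervals, hence a long cycle, k times over.  So a set X of O(tk²) vertices
-- makes every component D of G ∖ B ∖ X attach to B ∖ X within a window of O(t) consecutive vertices, with fewer than
-- k vertices outside D having a long cycle through D.
--
-- Vertices are now laid out one by one: X, then B in its order, each D as soon as its neighbours are there.  Inside D
-- the search tree is traversed with a child that has many outside neighbours last.  A subtree joined to the rest of D
-- only at its parent has, by (k+1)-connectivity, an outside neighbour not closing a long cycle with D; such
-- neighbours of two subtrees at distance t are disjoint, so only O(log(tk)) = O(t + k) turns into a light child
-- matter, and between two turns only O(t²) vertices are held, since t² nested subtrees none of which is a cut subtree
-- create a long cycle.

module Submission where

open import Defs
open import Data.Nat using (ℕ; zero; suc; _+_; _*_; _∸_; _^_; _≤_; _<_; _⊔_; z≤n; s≤s; _≤?_; NonZero; >-nonZero)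
open import Data.Nat.Properties
open import Data.Nat.Tactic.RingSolver using (solve-∀)
open import Data.Bool using (T)
open import Data.Bool.Properties using (T?)
open import Data.Fin using (Fin; zero; suc; combine)
import Data.Fin.Properties as F
open import Data.Fin.Subset using (Subset; inside; outside; ∣_∣) renaming (_∈_ to _∈ˢ_)
open import Data.Vec.Base using ([]; _∷_; here; there)
open import Data.Vec.Functional using () renaming (foldr to vfoldr)
open import Data.List using (List; []; _∷_; length; _++_; _∷ʳ_; map; filter; reverse; allFin; take; drop; concat; lookup; cartesianProduct)
open import Data.List.Properties using (length-++; length-++-sucʳ; ++-assoc; ++-identityʳ; length-reverse; unfold-reverse; length-map; length-take; length-tabulate; filter-++; filter-none; filter-all; length-filter)
open import Data.List.Membership.Propositional using (_∈_; _∉_; lose)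
open import Data.List.Membership.Propositional.Properties using (∈-∃++; ∈-filter⁺; ∈-filter⁻; ∈-++⁺ˡ; ∈-++⁺ʳ; ∈-++⁻; ∈-allFin; ∈-map⁺; ∈-map⁻; ∈-lookup; ∈-cartesianProduct⁺)
open import Data.List.Relation.Unary.Any using (Any; here; there; any?)
import Data.List.Relation.Unary.Any.Properties as AnyP
open import Data.List.Relation.Unary.All as All using (All; []; _∷_; all?)
import Data.List.Relation.Unary.All.Properties as AllP
open import Data.List.Relation.Unary.AllPairs as AllPairs using (AllPairs; []; _∷_)
import Data.List.Relation.Unary.AllPairs.Properties as AP
open import Data.List.Relation.Unary.Linked using (Linked; []; [-]; _∷_; linked?)
open import Data.List.Relation.Unary.Unique.Propositional using (Unique)
import Data.List.Relation.Unary.Unique.Propositional.Properties as Uniq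
import Data.List.Relation.Unary.Unique.DecPropositional as UniqDec
open import Data.Product using (Σ; ∃; _×_; _,_; proj₁; proj₂)
open import Data.Sum using (_⊎_; inj₁; inj₂; [_,_]′)
open import Data.Empty using (⊥; ⊥-elim)
open import Data.Unit using (⊤; tt)
open import Function using (_∘_; id; case_of_)
open import Relation.Nullary using (¬_; Dec; yes; no; contradiction)
open import Relation.Nullary.Decidable using (¬?; _×-dec_; _⊎-dec_; map′; does)
open import Relation.Binary.PropositionalEquality using (_≡_; _≢_; refl; trans; cong; cong₂; subst; subst₂) renaming (sym to symm)

-- Duplicate-free lists and bounded search.

module Lists where

  ⊆-length : ∀ {A : Set} {xs ys : List A} → Unique xs → (∀ {x} → x ∈ xs → x ∈ ys) → length xs ≤ length ys
  ⊆-length {xs = []} _ _ = z≤n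
  ⊆-length {xs = x ∷ xs} (x∉ ∷ u) s with ∈-∃++ (s (here refl))
  ... | ys₁ , ys₂ , refl =
    subst (suc (length xs) ≤_) (symm (length-++-sucʳ ys₁ x ys₂)) (s≤s (⊆-length u s′))
    where
    s′ : ∀ {y} → y ∈ xs → y ∈ ys₁ ++ ys₂
    s′ y∈ with ∈-++⁻ ys₁ (s (there y∈))
    ... | inj₁ p = ∈-++⁺ˡ p
    ... | inj₂ (here refl) = contradiction refl (All.lookup x∉ y∈)
    ... | inj₂ (there p) = ∈-++⁺ʳ ys₁ p

  unique-reverse : ∀ {A : Set} {xs : List A} → Unique xs → Unique (reverse xs)
  unique-reverse {xs = []} _ = []
  unique-reverse {xs = x ∷ xs} (x∉ ∷ u) rewrite unfold-reverse x xs =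
    Uniq.++⁺ (unique-reverse u) ([] ∷ []) λ { (p , here refl) → All.lookup x∉ (AnyP.reverse⁻ p) refl }

  all-reverse : ∀ {A : Set} {P : A → Set} {xs : List A} → All P xs → All P (reverse xs)
  all-reverse ps = All.tabulate (λ p → All.lookup ps (AnyP.reverse⁻ p))

  -- Spines are listed with the most recent vertex first, so the last hit in the list is the
  -- ancestor nearest to the root.
  topmost : ∀ {A : Set} {P : A → Set} → (∀ x → Dec (P x)) → ∀ {xs} → Any P xs →
    Σ (List A) λ ys → Σ A λ x → Σ (List A) λ zs → xs ≡ ys ++ x ∷ zs × P x × ¬ Any P zs
  topmost P? {x ∷ xs} p with any? P? xs
  ... | yes q with topmost P? q
  ...   | ys , y , zs , refl , py , nz = x ∷ ys , y , zs , refl , py , nz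
  topmost P? {x ∷ xs} (here px) | no ¬q = [] , x , xs , refl , px , ¬q
  topmost P? {x ∷ xs} (there q) | no ¬q = contradiction q ¬q

  -- Exhaustive search over vertex lists; it makes the existence of a long cycle decidable, so that
  -- the greedy arguments can branch on it.
  some-list : ∀ {n} (m : ℕ) {Q : List (Fin n) → Set} → (∀ l → Dec (Q l)) →
    Dec (Σ (List (Fin n)) λ l → length l ≤ m × Q l)
  some-list zero {Q} Q? = map′ (λ q → [] , z≤n , q) (λ { ([] , _ , q) → q ; (_ ∷ _ , () , _) }) (Q? [])
  some-list {n} (suc m) {Q} Q? =
    map′ (λ { (inj₁ q) → [] , z≤n , q ; (inj₂ (x , l , le , q)) → x ∷ l , s≤s le , q })
         (λ { ([] , _ , q) → inj₁ q ; (x ∷ l , s≤s le , q) → inj₂ (x , l , le , q) })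
         (Q? [] ⊎-dec F.any? (λ x → some-list m (λ l → Q? (x ∷ l))))

  unique-length : ∀ {n} {l : List (Fin n)} → Unique l → length l ≤ n
  unique-length {n} {l} u = subst (length l ≤_) (length-allFin n) (⊆-length u (λ _ → ∈-allFin _))
    where
    length-allFin : ∀ n → length (allFin n) ≡ n
    length-allFin n = length-tabulate {n = n} id

open Lists public

-- Decidable vertex sets and their cardinalities.

module Sets (n : ℕ) where

  V : Set
  V = Fin n

  open import Data.List.Membership.DecPropositional (F._≟_ {n}) using (_∈?_) public

  -- With decidable predicates, union, difference and inclusion unfold to sums, products and
  -- functions; `Subset` is met only where connectivity is used and where bags are output.
  record VS : Set₁ where
    constructor vs
    field
      Mem  : V → Set
      mem? : ∀ v → Dec (Mem v)
  open VS public

  infix 4 _∋_ _⊑_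
  _∋_ : VS → V → Set
  K ∋ v = Mem K v

  _⊑_ : VS → VS → Set
  K ⊑ L = ∀ {v} → K ∋ v → L ∋ v

  infixl 6 _∪_ _∖_ _─_
  _∪_ _∖_ : VS → VS → VS
  K ∪ L = vs (λ v → K ∋ v ⊎ L ∋ v) (λ v → mem? K v ⊎-dec mem? L v)
  K ∖ L = vs (λ v → K ∋ v × ¬ (L ∋ v)) (λ v → mem? K v ×-dec ¬? (mem? L v))

  ⟨_⟩ : V → VS
  ⟨ c ⟩ = vs (_≡ c) (F._≟ c)

  _─_ : VS → V → VS
  K ─ c = K ∖ ⟨ c ⟩

  lst : List V → VS
  lst l = vs (_∈ l) (_∈? l)

  all : VS
  all = vs (λ _ → ⊤) (λ _ → yes tt)

  els : VS → List V
  els K = filter (mem? K) (allFin n)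

  els⁺ : ∀ K {v} → K ∋ v → v ∈ els K
  els⁺ K {v} p = ∈-filter⁺ (mem? K) (∈-allFin v) p

  els⁻ : ∀ K {v} → v ∈ els K → K ∋ v
  els⁻ K p = proj₂ (∈-filter⁻ (mem? K) {xs = allFin n} p)

  els-unique : ∀ K → Unique (els K)
  els-unique K = Uniq.filter⁺ (mem? K) (Uniq.allFin⁺ n)

  cnt : VS → ℕ
  cnt K = length (els K)

  cnt-list : ∀ K l → (∀ {v} → K ∋ v → v ∈ l) → cnt K ≤ length l
  cnt-list K l s = ⊆-length (els-unique K) (λ p → s (els⁻ K p))

  cnt-mono : ∀ K L → K ⊑ L → cnt K ≤ cnt L
  cnt-mono K L s = cnt-list K (els L) (λ p → els⁺ L (s p))

  cnt-strict : ∀ K L → K ⊑ L → ∀ {x} → L ∋ x → ¬ (K ∋ x) → cnt K < cnt L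
  cnt-strict K L s {x} lx kx =
    ⊆-length {xs = x ∷ els K} (All.tabulate (λ { p refl → kx (els⁻ K p) }) ∷ els-unique K)
      λ { (here refl) → els⁺ L lx ; (there p) → els⁺ L (s (els⁻ K p)) }

  cnt-disjoint : ∀ K L M → K ⊑ M → L ⊑ M → (∀ {v} → K ∋ v → L ∋ v → ⊥) → cnt K + cnt L ≤ cnt M
  cnt-disjoint K L M s r d =
    subst (_≤ cnt M) (length-++ (els K))
      (⊆-length (Uniq.++⁺ (els-unique K) (els-unique L) (λ { (p , q) → d (els⁻ K p) (els⁻ L q) }))
        λ p → [ (λ q → els⁺ M (s (els⁻ K q))) , (λ q → els⁺ M (r (els⁻ L q))) ]′ (∈-++⁻ (els K) p))

  cnt-inhabited : ∀ K {v} → K ∋ v → 1 ≤ cnt K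
  cnt-inhabited K {v} p = ⊆-length {xs = v ∷ []} ([] ∷ []) (λ { (here refl) → els⁺ K p })

  some : ∀ (K : VS) {P : V → Set} → (∀ v → Dec (P v)) → Dec (∃ λ v → K ∋ v × P v)
  some K P? = F.any? (λ v → mem? K v ×-dec P? v)

-- Translation between decidable predicates, lists and `Subset`.

module Subsets where

  toSubset : ∀ {n} {P : Fin n → Set} → (∀ v → Dec (P v)) → Subset n
  toSubset {zero} P? = []
  toSubset {suc n} P? = does (P? zero) ∷ toSubset (P? ∘ suc)

  toSubset⁺ : ∀ {n} {P : Fin n → Set} (P? : ∀ v → Dec (P v)) {v} → P v → v ∈ˢ toSubset P?
  toSubset⁺ {suc n} P? {zero} p with P? zero
  ... | yes _ = here
  ... | no ¬p = contradiction p ¬p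
  toSubset⁺ {suc n} P? {suc v} p = there (toSubset⁺ (P? ∘ suc) p)

  toSubset⁻ : ∀ {n} {P : Fin n → Set} (P? : ∀ v → Dec (P v)) {v} → v ∈ˢ toSubset P? → P v
  toSubset⁻ {suc n} P? {zero} m with P? zero | m
  ... | yes p | here = p
  ... | no _ | ()
  toSubset⁻ {suc n} P? {suc v} (there m) = toSubset⁻ (P? ∘ suc) m

  elements : ∀ {n} → Subset n → List (Fin n)
  elements [] = []
  elements (inside ∷ p) = zero ∷ map suc (elements p)
  elements (outside ∷ p) = map suc (elements p)

  elements⁻ : ∀ {n} (p : Subset n) {v} → v ∈ elements p → v ∈ˢ p
  elements⁻ (inside ∷ p) (here refl) = here
  elements⁻ (inside ∷ p) (there m) with ∈-map⁻ suc m
  ... | _ , q , refl = there (elements⁻ p q)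
  elements⁻ (outside ∷ p) m with ∈-map⁻ suc m
  ... | _ , q , refl = there (elements⁻ p q)

  elements-unique : ∀ {n} (p : Subset n) → Unique (elements p)
  elements-unique [] = []
  elements-unique (inside ∷ p) =
    All.tabulate (λ m e → case ∈-map⁻ suc m of λ { (_ , _ , q) → F.0≢1+n (trans e q) })
      ∷ Uniq.map⁺ F.suc-injective (elements-unique p)
  elements-unique (outside ∷ p) = Uniq.map⁺ F.suc-injective (elements-unique p)

  length-elements : ∀ {n} (p : Subset n) → length (elements p) ≡ ∣ p ∣
  length-elements [] = refl
  length-elements (inside ∷ p) = cong suc (trans (length-map suc (elements p)) (length-elements p))
  length-elements (outside ∷ p) = trans (length-map suc (elements p)) (length-elements p)

  ∣∣≤length : ∀ {n} (p : Subset n) (l : List (Fin n)) → (∀ {v} → v ∈ˢ p → v ∈ l) → ∣ p ∣ ≤ length l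
  ∣∣≤length p l s = subst (_≤ length l) (length-elements p) (⊆-length (elements-unique p) (s ∘ elements⁻ p))

open Subsets public

-- Paths, walks and connected components.

module Walks {n : ℕ} (G : Graph n) where

  open Sets n public

  adj-sym : ∀ {x y} → Adj G x y → Adj G y x
  adj-sym {x} {y} = subst T (Graph.sym G x y)

  adj-irrefl : ∀ {x} → ¬ Adj G x x
  adj-irrefl {x} = subst T (irrefl G x)

  adj? : ∀ x y → Dec (Adj G x y)
  adj? x y = T? (adj G x y)

  -- `Path` exposes its vertex list, ready to be closed into a cycle, whereas `Walk` below only
  -- stays inside a set; `toSimple` passes from the second to the first.
  data Path : V → V → List V → Set where
    stop : ∀ {x} → Path x x (x ∷ [])
    _∷_  : ∀ {x y z l} → Adj G x y → Path y z l → Path x z (x ∷ l)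

  joinPath : ∀ {x y z w l m} → Path x y l → Adj G y z → Path z w m → Path x w (l ++ m)
  joinPath stop a q = a ∷ q
  joinPath (b ∷ p) a q = b ∷ joinPath p a q

  reversePath : ∀ {x y l} → Path x y l → Path y x (reverse l)
  reversePath stop = stop
  reversePath {x} (_∷_ {l = l} a p) rewrite unfold-reverse x l = joinPath (reversePath p) (adj-sym a) stop

  path-linked : ∀ {x y z l} → Path x y l → Adj G y z → Linked (Adj G) (l ∷ʳ z)
  path-linked stop a = a ∷ [-]
  path-linked (b ∷ stop) a = b ∷ a ∷ [-]
  path-linked (b ∷ p@(_ ∷ _)) a = b ∷ path-linked p a

  path-nonempty : ∀ {x y l} → Path x y l → 1 ≤ length l
  path-nonempty stop = s≤s z≤n
  path-nonempty (_ ∷ _) = s≤s z≤n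

  record Simple (K : VS) (x y : V) : Set where
    constructor simple
    field
      verts  : List V
      path   : Path x y verts
      uniq   : Unique verts
      within : All (K ∋_) verts
  open Simple public

  infixr 5 _∷_
  data Walk (K : VS) : V → V → Set where
    []  : ∀ {x} → K ∋ x → Walk K x x
    _∷_ : ∀ {x y z} → K ∋ x × Adj G x y → Walk K y z → Walk K x z

  walk-start : ∀ {K x y} → Walk K x y → K ∋ x
  walk-start ([] p) = p
  walk-start ((p , _) ∷ _) = p

  walk-end : ∀ {K x y} → Walk K x y → K ∋ y
  walk-end ([] p) = p
  walk-end (_ ∷ w) = walk-end w

  infixr 5 _⊕_
  _⊕_ : ∀ {K x y z} → Walk K x y → Walk K y z → Walk K x z
  [] _ ⊕ v = v
  (e ∷ w) ⊕ v = e ∷ (w ⊕ v)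

  snoc : ∀ {K x y z} → Walk K x y → Adj G y z → K ∋ z → Walk K x z
  snoc w a p = w ⊕ ((walk-end w , a) ∷ [] p)

  walk-sym : ∀ {K x y} → Walk K x y → Walk K y x
  walk-sym ([] p) = [] p
  walk-sym ((p , a) ∷ w) = snoc (walk-sym w) (adj-sym a) p

  walk-mono : ∀ {K L x y} → K ⊑ L → Walk K x y → Walk L x y
  walk-mono s ([] p) = [] (s p)
  walk-mono s ((p , a) ∷ w) = (s p , a) ∷ walk-mono s w

  -- The common form of all separation arguments: a walk cannot escape a property that every edge
  -- inside K preserves.
  walk-closed : ∀ {K x y} {P : V → Set} → (∀ {a b} → P a → K ∋ a → K ∋ b → Adj G a b → P b) →
    P x → Walk K x y → P y
  walk-closed c p ([] _) = p
  walk-closed c p ((k , a) ∷ w) = walk-closed c (c p k (walk-start w) a) w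

  private
    suffix : ∀ {K x y z l} → x ∈ l → Path y z l → Unique l → All (K ∋_) l → Simple K x z
    suffix (here refl) stop u s = simple _ stop u s
    suffix (here refl) (a ∷ p) u s = simple _ (a ∷ p) u s
    suffix (there m) (a ∷ p) (_ ∷ u) (_ ∷ s) = suffix m p u s

  toSimple : ∀ {K x y} → Walk K x y → Simple K x y
  toSimple ([] p) = simple _ stop ([] ∷ []) (p ∷ [])
  toSimple {x = x} ((p , a) ∷ w) with toSimple w
  ... | simple l q u s with x ∈? l
  ...   | yes m = suffix m q u s
  ...   | no m∉ = simple (x ∷ l) (a ∷ q) (All.tabulate (λ { m refl → m∉ m }) ∷ u) (p ∷ s)

  Conn : VS → Set
  Conn K = ∀ {x y} → K ∋ x → K ∋ y → Walk K x y

  conn-from : ∀ {K c} → (∀ {v} → K ∋ v → Walk K c v) → Conn K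
  conn-from f p q = walk-sym (f p) ⊕ f q

  Closed : VS → VS → Set
  Closed M C = ∀ {a b} → C ∋ a → M ∋ b → Adj G a b → C ∋ b

  record Comp (M C : VS) : Set where
    field
      sub    : C ⊑ M
      point  : V
      point∈ : C ∋ point
      conn   : Conn C
      clos   : Closed M C
  open Comp public

  private
    -- The fuel m bounds the vertices of M not yet reached. Each round adds one neighbour, and R is
    -- a component once no edge inside M leaves it.
    grow : ∀ m M (R : VS) {w} → R ⊑ M → R ∋ w → (∀ {v} → R ∋ v → Walk R w v) → cnt (M ∖ R) ≤ m →
      Σ VS λ C → Comp M C × C ∋ w
    grow m M R {w} s r f le with F.any? (λ a → mem? R a ×-dec some (M ∖ R) (adj? a))
    grow m M R {w} s r f le | no ¬e = R , record
      { sub = s ; point = w ; point∈ = r ; conn = conn-from f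
      ; clos = λ {a} {b} p q e → case mem? R b of λ
          { (yes x) → x ; (no x) → contradiction (a , p , b , (q , x) , e) ¬e } } , r
    grow m M R {w} s r f le | yes (a , ra , b , (mb , nb) , e) = more m le
      where
      R′ = R ∪ ⟨ b ⟩
      f′ : ∀ {v} → R′ ∋ v → Walk R′ w v
      f′ (inj₁ p) = walk-mono inj₁ (f p)
      f′ (inj₂ refl) = snoc (walk-mono inj₁ (f ra)) e (inj₂ refl)
      lt : cnt (M ∖ R′) < cnt (M ∖ R)
      lt = cnt-strict (M ∖ R′) (M ∖ R) (λ { (p , q) → p , λ z → q (inj₁ z) }) (mb , nb) λ { (_ , q) → q (inj₂ refl) }
      more : ∀ m → cnt (M ∖ R) ≤ m → _
      more zero le = contradiction (≤-trans lt le) λ ()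
      more (suc m) le = grow m M R′ (λ { (inj₁ p) → s p ; (inj₂ refl) → mb }) (inj₁ r) f′ (≤-pred (≤-trans lt le))

  component : ∀ M {w} → M ∋ w → Σ VS λ C → Comp M C × C ∋ w
  component M {w} p = grow _ M ⟨ w ⟩ (λ { refl → p }) refl (λ { refl → [] refl }) ≤-refl

  comp-walk : ∀ {M C x y} → Comp M C → C ∋ x → Walk M x y → C ∋ y
  comp-walk c p w = walk-closed (λ q _ m e → clos c q m e) p w

  Touch : VS → V → Set
  Touch K b = ∃ λ a → K ∋ a × Adj G a b

  touch? : ∀ K b → Dec (Touch K b)
  touch? K b = some K (λ a → adj? a b)

-- Long cycles and packings of disjoint long cycles.

module Cycles {n : ℕ} (G : Graph n) (t : ℕ) (3≤t : 3 ≤ t) where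

  open Walks G public

  IsLong : List V → Set
  IsLong [] = ⊥
  IsLong (x ∷ l) = t ≤ suc (length l) × Unique (x ∷ l) × Linked (Adj G) ((x ∷ l) ∷ʳ x)

  isLong? : ∀ l → Dec (IsLong l)
  isLong? [] = no λ ()
  isLong? (x ∷ l) = (t ≤? suc (length l)) ×-dec (UniqDec.unique? F._≟_ (x ∷ l) ×-dec linked? adj? ((x ∷ l) ∷ʳ x))

  LongIn : (V → Set) → Set
  LongIn P = Σ (List V) λ l → IsLong l × All P l

  Long : VS → Set
  Long K = LongIn (K ∋_)

  long-mono : ∀ {P Q : V → Set} → (∀ {v} → P v → Q v) → LongIn P → LongIn Q
  long-mono s (l , c , a) = l , c , All.map s a

  -- A cycle has no repeated vertex, so lists of at most n entries suffice for the search.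
  long? : ∀ K → Dec (Long K)
  long? K = map′ (λ { (l , _ , c) → l , c }) (λ { (l , c , a) → l , unique-length (isLong-unique l c) , c , a })
              (some-list n (λ l → isLong? l ×-dec all? (mem? K) l))
    where
    isLong-unique : ∀ l → IsLong l → Unique l
    isLong-unique (x ∷ l) (_ , u , _) = u

  closePath : ∀ {P x y l} → Path x y l → Adj G y x → Unique l → All P l → t ≤ length l → LongIn P
  closePath stop a u s le = _ , (le , u , path-linked stop a) , s
  closePath (b ∷ p) a u s le = _ , (le , u , path-linked (b ∷ p) a) , s

  -- The bound 3 ≤ t excludes a single edge walked back and forth.
  toCycle : ∀ {l} → IsLong l → Σ (Cycle G) λ C → (t ≤ cycleLength C) × (cycleVertices C ≡ l)
  toCycle {x ∷ l} (le , u , c) = record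
    { start = x ; rest = l ; long = ≤-pred (≤-trans 3≤t le) ; unique = u ; closed = c } , le , refl

  -- Disjointness is encoded by shrinking the set available to the later cycles, which suits greedy
  -- constructions that add one cycle at a time.
  Pack : ℕ → (V → Set) → Set
  Pack zero P = ⊤
  Pack (suc k) P = Σ (List V) λ l → IsLong l × All P l × Pack k (λ v → P v × v ∉ l)

  pack-mono : ∀ k {P Q : V → Set} → (∀ {v} → P v → Q v) → Pack k P → Pack k Q
  pack-mono zero s _ = tt
  pack-mono (suc k) s (l , c , a , p) = l , c , All.map s a , pack-mono k (λ { (x , y) → s x , y }) p

  private
    cyc : ∀ k {P} → Pack k P → Fin k → List V
    cyc (suc k) (l , _) zero = l
    cyc (suc k) (_ , _ , _ , p) (suc i) = cyc k p i

    cyc-long : ∀ k {P} (p : Pack k P) i → IsLong (cyc k p i)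
    cyc-long (suc k) (_ , c , _) zero = c
    cyc-long (suc k) (_ , _ , _ , p) (suc i) = cyc-long k p i

    cyc-in : ∀ k {P} (p : Pack k P) i → All P (cyc k p i)
    cyc-in (suc k) (_ , _ , a , _) zero = a
    cyc-in (suc k) (_ , _ , _ , p) (suc i) = All.map proj₁ (cyc-in k p i)

    cyc-disjoint : ∀ k {P} (p : Pack k P) i j → i ≢ j → ∀ x → x ∈ cyc k p i → ¬ (x ∈ cyc k p j)
    cyc-disjoint (suc k) p zero zero ne x a b = ne refl
    cyc-disjoint (suc k) (l , _ , _ , p) zero (suc j) ne x a b = proj₂ (All.lookup (cyc-in k p j) b) a
    cyc-disjoint (suc k) (l , _ , _ , p) (suc i) zero ne x a b = proj₂ (All.lookup (cyc-in k p i) a) b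
    cyc-disjoint (suc k) (l , _ , _ , p) (suc i) (suc j) ne x a b =
      cyc-disjoint k p i j (λ e → ne (cong suc e)) x a b

  pack⇒disjoint : ∀ k {P} → Pack k P → HasDisjointLongCycles G k t
  pack⇒disjoint k p =
    (λ i → proj₁ (C i)) , (λ i → proj₁ (proj₂ (C i))) ,
    λ i j ne x a b → cyc-disjoint k p i j ne x (subst (x ∈_) (proj₂ (proj₂ (C i))) a) (subst (x ∈_) (proj₂ (proj₂ (C j))) b)
    where C = λ i → toCycle (cyc-long k p i)

unique-++ˡ : ∀ {A : Set} (xs : List A) {ys} → Unique (xs ++ ys) → Unique xs
unique-++ˡ [] u = []
unique-++ˡ (x ∷ xs) (p ∷ u) = AllP.++⁻ˡ xs p ∷ unique-++ˡ xs u

-- Depth-first search, ears over the spine, and the bounds that follow from having no long cycle.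

module Spines {n : ℕ} (G : Graph n) (t : ℕ) (3≤t : 3 ≤ t) (S : Sets.VS n) where

  open Cycles G t 3≤t public

  AdjHead : V → List V → Set
  AdjHead c [] = ⊤
  AdjHead c (a ∷ _) = Adj G c a

  -- Sp K as: depth-first search inside S has walked the path as (most recent vertex first)
  -- and K is a component of what remains, so that the subtree hanging below the head of as spans K.
  data Sp : VS → List V → Set₁ where
    root : ∀ {K} → Comp S K → Sp K []
    down : ∀ {K as} → Sp K as → ∀ c → K ∋ c → AdjHead c as → ∀ {C} → Comp (K ─ c) C → Sp C (c ∷ as)

  sp-conn : ∀ {K as} → Sp K as → Conn K
  sp-conn (root c) = conn c
  sp-conn (down _ _ _ _ c) = conn c

  sp-point : ∀ {K as} → Sp K as → ∃ λ v → K ∋ v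
  sp-point (root c) = _ , point∈ c
  sp-point (down _ _ _ _ c) = _ , point∈ c

  sp-sub : ∀ {K as} → Sp K as → K ⊑ S
  sp-sub (root c) = sub c
  sp-sub (down sp _ _ _ c) p = sp-sub sp (proj₁ (sub c p))

  -- The depth-first property that no edge joins different branches: passing to a component of
  -- `K ─ c` adds only c to the possible neighbours.
  sp-out : ∀ {K as} → Sp K as → ∀ {a b} → K ∋ a → S ∋ b → Adj G a b → K ∋ b ⊎ b ∈ as
  sp-out (root c) p q e = inj₁ (clos c p q e)
  sp-out (down sp c _ _ C) {a} {b} p q e with sp-out sp (proj₁ (sub C p)) q e
  ... | inj₂ m = inj₂ (there m)
  ... | inj₁ k with b F.≟ c
  ...   | yes refl = inj₂ (here refl)
  ...   | no ne = inj₁ (clos C p (k , ne) e)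

  sp-disjoint : ∀ {K as} → Sp K as → ∀ {v} → K ∋ v → v ∉ as
  sp-disjoint (down sp c _ _ C) p (here refl) = proj₂ (sub C p) refl
  sp-disjoint (down sp c _ _ C) p (there m) = sp-disjoint sp (proj₁ (sub C p)) m

  sp-unique : ∀ {K as} → Sp K as → Unique as
  sp-unique (root _) = []
  sp-unique (down sp c p _ _) = All.tabulate (λ { m refl → sp-disjoint sp p m }) ∷ sp-unique sp

  sp-anc : ∀ {K as} → Sp K as → All (S ∋_) as
  sp-anc (root _) = []
  sp-anc (down sp c p _ _) = sp-sub sp p ∷ sp-anc sp

  -- The walk is stopped at its first visit to c. Before that it cannot enter C, which is a
  -- component after the removal of c.
  walk-avoid : ∀ {K C c y} → Comp (K ─ c) C → ¬ (C ∋ y) → Walk K y c → Walk (K ∖ C) y c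
  walk-avoid C n ([] p) = [] (p , n)
  walk-avoid {C = D} {c} {y} C n (_∷_ {y = z} (p , a) w) with y F.≟ c
  ... | yes refl = [] (p , n)
  ... | no ne = ((p , n) , a) ∷ walk-avoid C (λ q → n (clos C q (p , ne) (adj-sym a))) w

  comp-touch : ∀ {K C c} → Conn K → K ∋ c → Comp (K ─ c) C → Touch C c
  comp-touch {K} {D} {c} k p C = go (point∈ C) (k (proj₁ (sub C (point∈ C))) p)
    where
    go : ∀ {x} → D ∋ x → Walk K x c → Touch D c
    go q ([] _) = contradiction refl (proj₂ (sub C q))
    go {x} q (_∷_ {y = y} (_ , a) w) with y F.≟ c
    ... | yes refl = x , q , a
    ... | no ne = go (clos C q (walk-start w , ne) a) w

  sp-head : ∀ {K c as} → Sp K (c ∷ as) → Touch K c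
  sp-head (down sp c p _ C) = comp-touch (sp-conn sp) p C

  pick : ∀ {K as} → Sp K as → ∃ λ c → K ∋ c × AdjHead c as
  pick {as = []} sp = proj₁ (sp-point sp) , proj₂ (sp-point sp) , tt
  pick {as = a ∷ as} sp = let c , p , e = sp-head sp in c , p , e

  -- Run m: none of the last m subtrees on the spine is joined to the rest of the tree through its parent only.
  Run : ∀ {K as} → ℕ → Sp K as → Set
  Run zero _ = ⊤
  Run (suc m) (root _) = ⊥
  Run (suc m) (down {as = as} sp _ _ _ {C} _) = Any (Touch C) as × Run m sp

  run-≤ : ∀ {K as} m m′ (sp : Sp K as) → m ≤ m′ → Run m′ sp → Run m sp
  run-≤ zero m′ sp le r = tt
  run-≤ (suc m) (suc m′) (down sp _ _ _ _) (s≤s le) (q , r) = q , run-≤ m m′ sp le r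

  -- The outcome of climbing from c to its ancestor l. C′ is the subtree below l containing c, and
  -- `link` reaches the rest of C′ from c without entering C, which is what prolonging an ear
  -- requires.
  record Up {C c} (as₁ : List V) (l : V) (as₂ : List V) (sp : Sp C (c ∷ as₁ ++ l ∷ as₂)) : Set₁ where
    field
      {C′}  : VS
      sp′   : Sp C′ (l ∷ as₂)
      incl  : C ⊑ C′
      link  : ∀ {y} → C′ ∋ y → ¬ (C ∋ y) → Walk (C′ ∖ C) c y
      c∈    : C′ ∋ c
      spine : Path c l (c ∷ as₁ ++ l ∷ [])
      run   : ∀ m → Run (suc (length as₁) + m) sp → Run m sp′

  climb : ∀ {C c} as₁ {l as₂} (sp : Sp C (c ∷ as₁ ++ l ∷ as₂)) → Up as₁ l as₂ sp
  climb [] (down sp c p h C) = record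
    { sp′ = sp ; incl = λ q → proj₁ (sub C q) ; c∈ = p
    ; link = λ q ne → walk-sym (walk-avoid C ne (sp-conn sp q p))
    ; spine = h ∷ stop ; run = λ m r → proj₂ r }
  climb (a ∷ as₁) (down {K} sp c p h {D} C) = record
    { sp′ = sp′ ; incl = λ q → incl (proj₁ (sub C q)) ; c∈ = incl p
    ; link = lnk ; spine = h ∷ spine ; run = λ m r → run m (proj₂ r) }
    where
    open Up (climb as₁ sp)
    lnk : ∀ {y} → C′ ∋ y → ¬ (D ∋ y) → Walk (C′ ∖ D) c y
    lnk {y} q ne with mem? K y
    ... | yes k = walk-mono (λ { (x , z) → incl x , z }) (walk-sym (walk-avoid C ne (sp-conn sp k p)))
    -- A vertex outside K is reached by going up from c to its parent and using the link there; that
    -- link avoids K, hence also D.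
    ... | no k = ((incl p , λ z → proj₂ (sub C z) refl) , h)
                   ∷ walk-mono (λ { (x , z) → x , λ w → z (proj₁ (sub C w)) }) (link q k)

  -- An ear of at least s inner vertices through C, from the parent of C to the highest ancestor that C touches.
  record Ear (s : ℕ) (C : VS) (c : V) (as : List V) : Set where
    field
      {as₁} : List V
      {top} : V
      {as₂} : List V
      split : as ≡ as₁ ++ top ∷ as₂
      none  : ¬ Any (Touch C) as₂
      {x y} : V
      {π}   : List V
      path  : Path x y π
      cx    : Adj G c x
      yt    : Adj G y top
      uniq  : Unique π
      within : All (C ∋_) π
      size  : s ≤ length π

  firstEar : ∀ {C c as} → Sp C (c ∷ as) → Any (Touch C) as → Ear 1 C c as
  firstEar {C} sp a with topmost (touch? C) a | sp-head sp
  ... | as₁ , l , as₂ , e , (y , cy , yl) , n | x , cx , xc with toSimple (sp-conn sp cx cy)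
  ... | simple π p u w = record
    { split = e ; none = n ; path = p ; cx = adj-sym xc ; yt = yl ; uniq = u ; within = w ; size = path-nonempty p }

  module _ (thin : ¬ Long S) where

    -- The tree path from c to the top of the ear and the path through C close up to a cycle inside
    -- S, which must not be long.
    ear-span : ∀ {s C c as} → Sp C (c ∷ as) → (e : Ear s C c as) → suc (suc (length (Ear.as₁ e))) + s ≤ t
    ear-span {s} {C} {c} {as} sp e with t ≤? suc (suc (length (Ear.as₁ e))) + s
    ... | no ¬p = <⇒≤ (≰⇒> ¬p)
    ... | yes le with e
    ... | record { as₁ = as₁ ; top = l ; as₂ = as₂ ; split = refl ; π = π ; path = p ; cx = cx ; yt = yt ; uniq = u ; within = w ; size = z } =
      contradiction (closePath (joinPath spine (adj-sym yt) (reversePath p)) (adj-sym cx) uq al len) thin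
      where
      open Up (climb as₁ sp)
      eq : c ∷ as₁ ++ l ∷ as₂ ≡ (c ∷ as₁ ++ l ∷ []) ++ as₂
      eq = cong (c ∷_) (symm (++-assoc as₁ (l ∷ []) as₂))
      uq : Unique ((c ∷ as₁ ++ l ∷ []) ++ reverse π)
      uq = Uniq.++⁺ (unique-++ˡ (c ∷ as₁ ++ l ∷ []) (subst Unique eq (sp-unique sp))) (unique-reverse u)
             λ { {v} (a , b) → sp-disjoint sp (All.lookup w (AnyP.reverse⁻ b)) (subst (v ∈_) (symm eq) (∈-++⁺ˡ a)) }
      al : All (S ∋_) ((c ∷ as₁ ++ l ∷ []) ++ reverse π)
      al = AllP.++⁺ (AllP.++⁻ˡ (c ∷ as₁ ++ l ∷ []) (subst (All (S ∋_)) eq (sp-anc sp)))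
             (all-reverse (All.map (sp-sub sp) w))
      open ≤-Reasoning
      len : t ≤ length ((c ∷ as₁ ++ l ∷ []) ++ reverse π)
      len = begin
        t ≤⟨ le ⟩
        suc (suc (length as₁)) + s ≤⟨ +-monoʳ-≤ (suc (suc (length as₁))) z ⟩
        suc (suc (length as₁)) + length π ≡⟨ cong₂ _+_ (cong suc (trans (symm (+-comm (length as₁) 1)) (symm (length-++ as₁)))) (symm (length-reverse π)) ⟩
        length (c ∷ as₁ ++ l ∷ []) + length (reverse π) ≡⟨ symm (length-++ (c ∷ as₁ ++ l ∷ [])) ⟩
        length ((c ∷ as₁ ++ l ∷ []) ++ reverse π) ∎

    -- The next ear starts below its predecessor's top but outside C, so the two can be linked through C′ ∖ C.
    nextEar : ∀ {s C c as} (sp : Sp C (c ∷ as)) (e : Ear s C c as) →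
      Σ VS λ C′ → Σ (Sp C′ (Ear.top e ∷ Ear.as₂ e)) λ sp′ →
        (∀ m → Run (suc (length (Ear.as₁ e)) + m) sp → Run m sp′) ×
        (Any (Touch C′) (Ear.as₂ e) → Ear (suc s) C′ (Ear.top e) (Ear.as₂ e))
    nextEar {s} {C} {c} sp record { as₁ = as₁ ; top = l ; as₂ = as₂ ; split = refl ; none = none ; π = π ; path = p ; cx = cx ; yt = yt ; uniq = u ; within = w ; size = z } =
      C′ , sp′ , run , new
      where
      open Up (climb as₁ sp)
      new : Any (Touch C′) as₂ → Ear (suc s) C′ l as₂
      new a with topmost (touch? C′) a
      ... | as₃ , l′ , as₄ , eq , (y , c′y , yl) , none′ with mem? C y
      ... | yes cy = contradiction (subst (Any (Touch C)) (symm eq) (AnyP.++⁺ʳ as₃ (here (y , cy , yl)))) none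
      ... | no ncy with toSimple (link c′y ncy)
      ... | simple ρ q v x = record
        { split = eq ; none = none′ ; path = joinPath (reversePath p) (adj-sym cx) q
        ; cx = adj-sym yt ; yt = yl
        ; uniq = Uniq.++⁺ (unique-reverse u) v (λ { (a , b) → proj₂ (All.lookup x b) (All.lookup w (AnyP.reverse⁻ a)) })
        ; within = AllP.++⁺ (all-reverse (All.map incl w)) (All.map proj₁ x)
        ; size = subst (suc s ≤_) (trans (cong (_+ length ρ) (symm (length-reverse π))) (symm (length-++ (reverse π))))
            (≤-trans (≤-reflexive (+-comm 1 s)) (+-mono-≤ z (path-nonempty q))) }

    -- Each round climbs fewer than t levels by `ear-span` and lengthens the ear by at least one
    -- vertex. After r rounds the ear has t inner vertices, too many for `ear-span`; the run
    -- guarantees that every intermediate subtree touches an ancestor above its parent.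
    chain : ∀ r {s C c as} (sp : Sp C (c ∷ as)) → t ≤ s + r → Ear s C c as → Run (r * t) sp → ⊥
    chain zero {s} sp le e _ =
      <-irrefl refl (≤-trans (s≤s (≤-trans le (≤-reflexive (+-identityʳ s))))
        (≤-trans (m≤n+m (suc s) (suc (length (Ear.as₁ e)))) (≤-trans (≤-reflexive (+-suc (suc (length (Ear.as₁ e))) s)) (ear-span sp e))))
    chain (suc r) {s} sp le e ru with nextEar sp e
    ... | C′ , sp′ , run , new = more sp′ run new
      where
      k = length (Ear.as₁ e)
      ru′ : Run (suc k + suc (r * t)) sp
      ru′ = run-≤ _ _ sp (subst (_≤ t + r * t) (symm (+-suc (suc k) (r * t)))
              (+-monoˡ-≤ (r * t) (≤-trans (m≤m+n (suc (suc k)) s) (ear-span sp e)))) ru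
      more : ∀ {C′} (sp′ : Sp C′ (Ear.top e ∷ Ear.as₂ e)) → (∀ m → Run (suc k + m) sp → Run m sp′) →
        (Any (Touch C′) (Ear.as₂ e) → Ear (suc s) C′ (Ear.top e) (Ear.as₂ e)) → ⊥
      more sp′@(down _ _ _ _ _) run new =
        let q = run _ ru′ in chain r sp′ (≤-trans le (≤-reflexive (+-suc s r))) (new (proj₁ q)) (run-≤ (r * t) (suc (r * t)) sp′ (n≤1+n _) q)

    no-long-run : ∀ {K as} (sp : Sp K as) → ¬ Run (suc (t * t)) sp
    no-long-run sp@(down _ _ _ _ _) (a , r) =
      chain t sp (n≤1+n t) (firstEar sp a) (run-≤ (t * t) (suc (t * t)) sp (n≤1+n _) (a , r))

    -- All touched ancestors lie between the parent and the top of the first ear, and `ear-span`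
    -- bounds that stretch.
    few-touched : ∀ {K as} → Sp K as → length (filter (touch? K) as) ≤ t
    few-touched (root _) = z≤n
    few-touched {K} {c ∷ as} sp with any? (touch? K) as
    ... | no ¬a = ≤-trans (filter-length c as) (≤-trans (s≤s (≤-reflexive (cong length (filter-none (touch? K) (AllP.¬Any⇒All¬ as ¬a))))) (≤-trans (s≤s z≤n) 3≤t))
      where
      filter-length : ∀ c as → length (filter (touch? K) (c ∷ as)) ≤ suc (length (filter (touch? K) as))
      filter-length c as with touch? K c
      ... | yes _ = ≤-refl
      ... | no _ = n≤1+n _
    ... | yes a = bound (ear-span sp e) (Ear.split e) (Ear.none e)
      where
      e = firstEar sp a
      bound : ∀ {as₁ l as₂} → suc (suc (length as₁)) + 1 ≤ t → as ≡ as₁ ++ l ∷ as₂ → ¬ Any (Touch K) as₂ →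
        length (filter (touch? K) (c ∷ as)) ≤ t
      bound {as₁} {l} {as₂} le refl none = begin
        length (filter (touch? K) (c ∷ as₁ ++ l ∷ as₂))
          ≡⟨ cong (λ z → length (filter (touch? K) (c ∷ z))) (symm (++-assoc as₁ (l ∷ []) as₂)) ⟩
        length (filter (touch? K) ((c ∷ as₁ ++ l ∷ []) ++ as₂))
          ≡⟨ cong length (filter-++ (touch? K) (c ∷ as₁ ++ l ∷ []) as₂) ⟩
        length (filter (touch? K) (c ∷ as₁ ++ l ∷ []) ++ filter (touch? K) as₂)
          ≡⟨ length-++ (filter (touch? K) (c ∷ as₁ ++ l ∷ [])) ⟩
        length (filter (touch? K) (c ∷ as₁ ++ l ∷ [])) + length (filter (touch? K) as₂)
          ≡⟨ cong (λ z → length (filter (touch? K) (c ∷ as₁ ++ l ∷ [])) + length z)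
               (filter-none (touch? K) (AllP.¬Any⇒All¬ as₂ none)) ⟩
        length (filter (touch? K) (c ∷ as₁ ++ l ∷ [])) + 0 ≡⟨ +-identityʳ _ ⟩
        length (filter (touch? K) (c ∷ as₁ ++ l ∷ [])) ≤⟨ length-filter (touch? K) (c ∷ as₁ ++ l ∷ []) ⟩
        suc (length (as₁ ++ l ∷ [])) ≡⟨ cong suc (length-++ as₁) ⟩
        suc (length as₁ + 1) ≤⟨ n≤1+n _ ⟩
        suc (suc (length as₁)) + 1 ≤⟨ le ⟩
        t ∎
        where open ≤-Reasoning

-- Linear layouts of bounded vertex separation and the path decompositions they give.

module Layouts {n : ℕ} (G : Graph n) (W : ℕ) where

  open Walks G public

  Bd : VS → List V → Set
  Bd P O = ∀ {p q} → P ∋ p → ¬ (P ∋ q) → Adj G p q → p ∈ O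

  -- A layout leading from P to Q. The bound on O at every step is the vertex separation bound,
  -- which corresponds to pathwidth; `done` asks for mutual inclusion because sets are predicates.
  data Ext : VS → VS → Set₁ where
    done : ∀ {P Q} → P ⊑ Q → Q ⊑ P → Ext P Q
    add  : ∀ {P Q} v O → ¬ (P ∋ v) → Bd P O → length O ≤ W → Ext (P ∪ ⟨ v ⟩) Q → Ext P Q

  ext-resp : ∀ {P P′ Q} → P ⊑ P′ → P′ ⊑ P → Ext P′ Q → Ext P Q
  ext-resp s r (done a b) = done (λ p → a (s p)) (λ p → r (b p))
  ext-resp s r (add v O f bd le e) = add v O (λ p → f (s p)) (λ p nq a → bd (s p) (λ q → nq (r q)) a) le
    (ext-resp (λ { (inj₁ p) → inj₁ (s p) ; (inj₂ p) → inj₂ p }) (λ { (inj₁ p) → inj₁ (r p) ; (inj₂ p) → inj₂ p }) e)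

  infixr 5 _▷_
  _▷_ : ∀ {P Q R} → Ext P Q → Ext Q R → Ext P R
  done s r ▷ e = ext-resp s r e
  add v O f bd le d ▷ e = add v O f bd le (d ▷ e)

  ext-to : ∀ {P Q Q′} → Q ⊑ Q′ → Q′ ⊑ Q → Ext P Q → Ext P Q′
  ext-to s r e = e ▷ done s r

  -- The bag of the step that adds v to P.
  Boundary : VS → V → VS
  Boundary P v = ⟨ v ⟩ ∪ vs (λ p → P ∋ p × ∃ λ q → ¬ (P ∋ q) × Adj G p q)
    (λ p → mem? P p ×-dec F.any? (λ q → ¬? (mem? P q) ×-dec adj? p q))

  private
    size : ∀ {P Q} → Ext P Q → ℕ
    size (done _ _) = 0
    size (add _ _ _ _ _ e) = suc (size e)

    bags : ∀ {P Q} (e : Ext P Q) → Fin (size e) → VS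
    bags (add {P} v _ _ _ _ _) zero = Boundary P v
    bags (add _ _ _ _ _ e) (suc i) = bags e i

    bags-size : ∀ {P Q} (e : Ext P Q) i → Σ (List V) λ l → (∀ {v} → bags e i ∋ v → v ∈ l) × length l ≤ suc W
    bags-size (add v O _ bd le _) zero = v ∷ O , (λ { (inj₁ refl) → here refl ; (inj₂ (p , q , nq , a)) → there (bd p nq a) }) , s≤s le
    bags-size (add _ _ _ _ _ e) (suc i) = bags-size e i

    bags-cover : ∀ {P Q} (e : Ext P Q) v → Q ∋ v → ¬ (P ∋ v) → ∃ λ i → bags e i ∋ v
    bags-cover (done _ r) v q np = contradiction (r q) np
    bags-cover (add w _ _ _ _ e) v q np with v F.≟ w
    ... | yes refl = zero , inj₁ refl
    ... | no ne with bags-cover e v q (λ { (inj₁ p) → np p ; (inj₂ p) → ne p })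
    ...   | i , x = suc i , x

    -- An edge is found in the bag of its later endpoint: at that moment the earlier endpoint still
    -- has an unplaced neighbour.
    bags-edge : ∀ {P Q} (e : Ext P Q) u v → Q ∋ u → Q ∋ v → Adj G u v → ¬ (P ∋ u × P ∋ v) →
      ∃ λ i → bags e i ∋ u × bags e i ∋ v
    bags-edge (done _ r) u v qu qv a n = contradiction (r qu , r qv) n
    bags-edge (add {P} w _ f _ _ e) u v qu qv a n with mem? (P ∪ ⟨ w ⟩) u ×-dec mem? (P ∪ ⟨ w ⟩) v
    ... | no n′ with bags-edge e u v qu qv a n′
    ...   | i , x = suc i , x
    bags-edge (add w _ f _ _ e) u v qu qv a n | yes (inj₁ p , inj₁ q) = contradiction (p , q) n
    bags-edge (add w _ f _ _ e) u v qu qv a n | yes (inj₁ p , inj₂ refl) = zero , inj₂ (p , v , f , a) , inj₁ refl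
    bags-edge (add w _ f _ _ e) u v qu qv a n | yes (inj₂ refl , inj₁ q) = zero , inj₁ refl , inj₂ (q , u , f , adj-sym a)
    bags-edge (add w _ f _ _ e) u v qu qv a n | yes (inj₂ refl , inj₂ refl) = contradiction a adj-irrefl

    bags-later : ∀ {P Q} (e : Ext P Q) v i → P ∋ v → bags e i ∋ v → ∃ λ q → ¬ (P ∋ q) × Adj G v q
    bags-later (add w _ f _ _ _) v zero p (inj₁ refl) = contradiction p f
    bags-later (add w _ f _ _ _) v zero p (inj₂ (_ , x)) = x
    bags-later (add w _ f _ _ e) v (suc i) p x with bags-later e v i (inj₁ p) x
    ... | q , nq , a = q , (λ z → nq (inj₁ z)) , a

    -- A neighbour that is unplaced at a later step was unplaced before, so a placed vertex leaves
    -- the bags only once.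
    bags-down : ∀ {P Q} (e : Ext P Q) v i j → Data.Fin._≤_ i j → P ∋ v → bags e j ∋ v → bags e i ∋ v
    bags-down e@(add _ _ _ _ _ _) v zero j le p x = inj₂ (p , bags-later e v j p x)
    bags-down (add _ _ _ _ _ e) v (suc i) (suc j) (s≤s le) p x = bags-down e v i j le (inj₁ p) x

    bags-interval : ∀ {P Q} (e : Ext P Q) v i j l → Data.Fin._≤_ i j → Data.Fin._≤_ j l →
      bags e i ∋ v → bags e l ∋ v → bags e j ∋ v
    bags-interval e@(add _ _ _ _ _ _) v zero zero l _ _ x _ = x
    bags-interval (add w _ _ _ _ e) v zero (suc j) (suc l) _ (s≤s le) (inj₁ refl) y = bags-down e v j l le (inj₂ refl) y
    bags-interval (add w _ _ _ _ e) v zero (suc j) (suc l) _ (s≤s le) (inj₂ (p , _)) y = bags-down e v j l le (inj₁ p) y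
    bags-interval (add _ _ _ _ _ e) v (suc i) (suc j) (suc l) (s≤s a) (s≤s b) x y = bags-interval e v i j l a b x y

    fold-max : ∀ m (f : Fin m → ℕ) → (∀ i → f i ≤ W) → vfoldr _⊔_ 0 f ≤ W
    fold-max zero f le = z≤n
    fold-max (suc m) f le = ⊔-lub (le zero) (fold-max m (f ∘ suc) (le ∘ suc))

  decomposition : ∀ {P Q} → Ext P Q → (∀ {v} → ¬ (P ∋ v)) → (∀ {v} → Q ∋ v) → PathwidthAtMost G W
  decomposition e em full = record
    { m = size e
    ; bag = λ i → toSubset (mem? (bags e i))
    ; covers = λ v → case bags-cover e v full em of λ { (i , x) → i , toSubset⁺ (mem? (bags e i)) x }
    ; interval = λ v i j l a b x y → toSubset⁺ (mem? (bags e j))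
        (bags-interval e v i j l a b (toSubset⁻ (mem? (bags e i)) x) (toSubset⁻ (mem? (bags e l)) y))
    ; edges = λ u v a → case bags-edge e u v full full a (λ { (p , _) → em p }) of
        λ { (i , x , y) → i , toSubset⁺ (mem? (bags e i)) x , toSubset⁺ (mem? (bags e i)) y }
    } , fold-max (size e) _ λ i → case bags-size e i of λ { (l , s , le) →
          ∸-monoˡ-≤ 1 (≤-trans (∣∣≤length _ l (λ x → s (toSubset⁻ (mem? (bags e i)) x))) le) }

-- The layout of one component D of a set without long cycles.  Z lists the outside vertices
-- that have a long cycle through D.
module LayComponent {n : ℕ} (G : Graph n) (t : ℕ) (3≤t : 3 ≤ t) (W k : ℕ) (D : Sets.VS n) (Z : List (Fin n))
  (D-conn : Walks.Conn G D)
  (thin : ¬ Cycles.Long G t 3≤t D)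
  (Z-size : length Z < k)
  (Z-out : ∀ {x} → x ∈ Z → ¬ Sets.Mem D x)
  (Z-good : ∀ {x} → ¬ Sets.Mem D x → x ∉ Z → ¬ Cycles.Long G t 3≤t (Sets._∪_ n D (Sets.⟨_⟩ n x)))
  (sep : ∀ (l : List (Fin n)) → length l ≤ k → ∀ {u v} → u ∉ l → v ∉ l → Walks.Walk G (Sets._∖_ n (Sets.all n) (Sets.lst n l)) u v)
  where

  open Spines G t 3≤t D
  open Layouts G W using (Ext; done; add; _▷_; ext-to; Bd)

  -- By `Z-good` these outside neighbours close no long cycle with D. Their number μ plays the part
  -- of the size in a heavy-path decomposition of the search tree.
  Nb : VS → VS
  Nb K = vs (λ x → ¬ (D ∋ x) × x ∉ Z × Touch K x) (λ x → ¬? (mem? D x) ×-dec (¬? (x ∈? Z) ×-dec touch? K x))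

  μ : VS → ℕ
  μ K = cnt (Nb K)

  nb-mono : ∀ {K L} → K ⊑ L → Nb K ⊑ Nb L
  nb-mono s (a , b , c , d , e) = a , b , c , s d , e

  μ-mono : ∀ K L → K ⊑ L → μ K ≤ μ L
  μ-mono K L s = cnt-mono (Nb K) (Nb L) (nb-mono {K} {L} s)

  -- Otherwise c and Z, at most k vertices in all, would separate C from g.
  cut-μ : ∀ {C c g as} → Sp C (c ∷ g ∷ as) → ¬ Any (Touch C) (g ∷ as) → 1 ≤ μ C
  cut-μ {C} {c} {g} {as} sp none with F.any? (mem? (Nb C))
  ... | yes (x , p) = cnt-inhabited (Nb C) p
  ... | no ¬p = contradiction (walk-closed cl (proj₂ (sp-point sp)) (sep (c ∷ Z) Z-size (a∉ (proj₂ (sp-point sp))) g∉)) (λ q → sp-disjoint sp q (there (here refl)))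
    where
    a∉ : ∀ {a} → C ∋ a → a ∉ c ∷ Z
    a∉ p (here refl) = sp-disjoint sp p (here refl)
    a∉ p (there z) = Z-out z (sp-sub sp p)
    g∉ : g ∉ c ∷ Z
    g∉ (here refl) with sp-unique sp
    ... | (ne ∷ _) ∷ _ = ne refl
    g∉ (there z) with sp-anc sp
    ... | _ ∷ d ∷ _ = Z-out z d
    cl : ∀ {a b} → C ∋ a → _ → (all ∖ lst (c ∷ Z)) ∋ b → Adj G a b → C ∋ b
    cl {a} {b} p _ (_ , nb) e with mem? D b
    ... | no nd = contradiction (b , nd , (λ z → nb (there z)) , a , p , e) ¬p
    ... | yes d with sp-out sp p d e
    ...   | inj₁ q = q
    ...   | inj₂ (here refl) = contradiction (here refl) nb
    ...   | inj₂ (there m) = contradiction (lose m (a , p , e)) none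

  -- The state when the subtree K is about to be placed. O is held throughout; a vertex of the spine
  -- part R that is not in O has unplaced neighbours only in K, so it may be released when the part
  -- of K still to be placed no longer touches it.
  record Ctx (K : VS) (as : List V) (P : VS) (O R : List V) : Set where
    field
      fresh : ∀ {v} → K ∋ v → ¬ (P ∋ v)
      anc   : All (P ∋_) as
      outer : ∀ {a b} → D ∋ a → ¬ (D ∋ b) → Adj G a b → P ∋ b
      rsub  : ∀ {v} → v ∈ R → v ∈ as
      bd    : ∀ {p q} → P ∋ p → ¬ (P ∋ q) → Adj G p q → p ∈ O ⊎ (K ∋ q × p ∈ R)
  open Ctx

  -- Why subtrees far below a turn have few outside neighbours: either the subtree was light already, or a heavy
  -- sibling H hangs at the turn and a common outside neighbour would close a long cycle through τ.
  data Turn (e : ℕ) (K : VS) (as : List V) (τ : List V) : Set₁ where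
    light : μ K < 2 ^ e → Turn e K as τ
    heavy : ∀ (H K⁺ : VS) {a c rest} → as ≡ τ ++ rest → Path a c τ → Touch H c → Conn H → H ⊑ D →
      (∀ {v} → H ∋ v → v ∉ τ) → (∀ {v} → H ∋ v → ¬ (K ∋ v)) → 2 ^ e ≤ μ H → K ⊑ K⁺ → H ⊑ K⁺ → μ K⁺ < 2 ^ suc e → Turn e K as τ

  turn-down : ∀ {e K as c C τ} (sp : Sp K as) → K ∋ c → AdjHead c as → C ⊑ K →
    Turn e K as τ → Turn e C (c ∷ as) (c ∷ τ)
  turn-down {K = K} {C = C} sp p h s (light lt) = light (≤-trans (s≤s (μ-mono C K s)) lt)
  turn-down sp p h s (heavy H K⁺ refl stop th ch hd h∉ hk le k⁺ h⁺ lt) =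
    heavy H K⁺ refl (h ∷ stop) th ch hd (λ { q (here refl) → hk q p ; q (there m) → h∉ q m }) (λ q z → hk q (s z)) le (λ z → k⁺ (s z)) h⁺ lt
  turn-down sp p h s (heavy H K⁺ refl (x ∷ π) th ch hd h∉ hk le k⁺ h⁺ lt) =
    heavy H K⁺ refl (h ∷ x ∷ π) th ch hd (λ { q (here refl) → hk q p ; q (there m) → h∉ q m }) (λ q z → hk q (s z)) le (λ z → k⁺ (s z)) h⁺ lt

  private
    head-touch : ∀ {K a c τ rest} → Sp K (τ ++ rest) → Path a c τ → Touch K a
    head-touch sp stop = sp-head sp
    head-touch sp (_ ∷ _) = sp-head sp

  -- A common outside neighbour of K and H would close a long cycle through K, τ and H, against
  -- `Z-good`. Hence the two neighbourhoods are disjoint inside that of K⁺, and H takes at least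
  -- half of the bound.
  turn-far : ∀ {e K as τ} → Sp K as → Turn e K as τ → t ≤ length τ → μ K < 2 ^ e
  turn-far sp (light lt) _ = lt
  turn-far {e} {K} {as} {τ} sp (heavy H K⁺ {rest = rest} refl π (h₁ , hh₁ , hc) ch hd h∉ hk le k⁺ h⁺ lt) far =
    +-cancelʳ-< (2 ^ e) (μ K) (2 ^ e) (≤-trans (s≤s (≤-trans (+-monoʳ-≤ (μ K) le) (cnt-disjoint (Nb K) (Nb H) (Nb K⁺) (nb-mono {K} {K⁺} k⁺) (nb-mono {H} {K⁺} h⁺) dis)))
      (subst (μ K⁺ <_) (cong (2 ^ e +_) (+-identityʳ (2 ^ e))) lt))
    where
    dis : ∀ {x} → Nb K ∋ x → Nb H ∋ x → ⊥
    dis {x} (x∉D , x∉Z , b , kb , bx) (_ , _ , h , hh , hx) with head-touch sp π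
    ... | k₁ , kk₁ , ka with toSimple (sp-conn sp kb kk₁) | toSimple (ch hh₁ hh)
    ... | simple π₁ p₁ u₁ w₁ | simple π₂ p₂ u₂ w₂ =
      Z-good x∉D x∉Z (closePath (adj-sym bx ∷ joinPath p₁ ka (joinPath π (adj-sym hc) p₂)) hx
        (All.tabulate (λ { m refl → x∉D (in-D m) }) ∷ uq) (inj₂ refl ∷ All.tabulate (λ m → inj₁ (in-D m)))
        (≤-trans far (≤-trans (≤-trans (m≤m+n (length τ) (length π₂)) (≤-reflexive (symm (length-++ τ))))
          (≤-trans (m≤n+m (length (τ ++ π₂)) (length π₁)) (≤-trans (≤-reflexive (symm (length-++ π₁))) (n≤1+n _))))))
      where
      in-D : ∀ {v} → v ∈ π₁ ++ τ ++ π₂ → D ∋ v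
      in-D m with ∈-++⁻ π₁ m
      ... | inj₁ q = sp-sub sp (All.lookup w₁ q)
      ... | inj₂ m′ with ∈-++⁻ τ m′
      ...   | inj₁ q = All.lookup (sp-anc sp) (∈-++⁺ˡ q)
      ...   | inj₂ q = hd (All.lookup w₂ q)
      uq : Unique (π₁ ++ τ ++ π₂)
      uq = Uniq.++⁺ u₁ (Uniq.++⁺ (unique-++ˡ τ (sp-unique sp)) u₂ λ { (a , b) → h∉ (All.lookup w₂ b) a })
        λ { (a , b) → case ∈-++⁻ τ b of λ { (inj₁ q) → sp-disjoint sp (All.lookup w₁ a) (∈-++⁺ˡ q)
                                          ; (inj₂ q) → hk (All.lookup w₂ q) (All.lookup w₁ a) } }

  -- Components are predicates and cannot be enumerated, so the search runs over vertices: every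
  -- component through w is contained in the computed one, and μ is monotone.
  heavy? : ∀ M e → (Σ VS λ C → Comp M C × 2 ^ e ≤ μ C) ⊎ (∀ {C} → Comp M C → μ C < 2 ^ e)
  heavy? M e with F.any? hv?
    where
    Hv : V → Set₁
    Hv w = Σ VS λ C → Comp M C × C ∋ w × 2 ^ e ≤ μ C
    hv? : ∀ w → Dec (Hv w)
    hv? w with mem? M w
    ... | no ¬m = no λ { (C , c , p , _) → ¬m (sub c p) }
    ... | yes m with component M m
    ... | C₀ , c₀ , p₀ with 2 ^ e ≤? μ C₀
    ...   | yes le = yes (C₀ , c₀ , p₀ , le)
    ...   | no ¬le = no λ { (C , c , p , le) → ¬le (≤-trans le (μ-mono C C₀ (λ q →
                comp-walk c₀ p₀ (walk-mono (sub c) (conn c p q))))) }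
  ... | yes (w , C , c , _ , le) = inj₁ (C , c , le)
  ... | no ¬h = inj₂ λ {C} c → ≰⇒> λ le → ¬h (point c , C , c , point∈ c , le)

  -- N is a union of components of `K ─ c`. When one of them is finished, all its neighbours are
  -- placed: they lie in it, on the spine, or outside D. So it adds nothing to what is held for the
  -- next.
  sweep : ∀ {K as} (sp : Sp K as) {c} → K ∋ c → ∀ {O} (f : ℕ) (N P : VS) →
    (∀ {C P′} → Comp (K ─ c) C → C ⊑ N → Ctx C (c ∷ as) P′ O [] → Ext P′ (P′ ∪ C)) →
    N ⊑ (K ─ c) → Closed (K ─ c) N → cnt N ≤ f → Ctx N (c ∷ as) P O [] → Ext P (P ∪ N)
  sweep {K} {as} sp {c} kc {O} f N P lay ns cl le cx with F.any? (mem? N)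
  ... | no ¬n = done inj₁ λ { (inj₁ p) → p ; (inj₂ q) → contradiction (_ , q) ¬n }
  sweep {K} {as} sp {c} kc {O} zero N P lay ns cl le cx | yes (w , p) = contradiction (≤-trans (cnt-inhabited N p) le) λ ()
  sweep {K} {as} sp {c} kc {O} (suc f) N P lay ns cl le cx | yes (w , p) with component N p
  ... | C , cc , cw = ext-to (λ { (inj₁ (inj₁ q)) → inj₁ q ; (inj₁ (inj₂ q)) → inj₂ (sub cc q) ; (inj₂ (q , _)) → inj₂ q })
                        (λ { (inj₁ q) → inj₁ (inj₁ q) ; (inj₂ q) → case mem? C _ of λ { (yes z) → inj₁ (inj₂ z) ; (no z) → inj₂ (q , z) } })
                        (lay cm (sub cc) cxC ▷ sweep sp kc f (N ∖ C) (P ∪ C) (λ c′ s → lay c′ (λ z → proj₁ (s z))) (λ z → ns (proj₁ z)) cl′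
                           (≤-pred (≤-trans (cnt-strict (N ∖ C) N proj₁ p (λ z → proj₂ z cw)) le)) cx′)
    where
    cm : Comp (K ─ c) C
    cm = record { sub = λ z → ns (sub cc z) ; point = w ; point∈ = cw ; conn = conn cc
                ; clos = λ a b e → clos cc a (cl (sub cc a) b e) e }
    cl′ : Closed (K ─ c) (N ∖ C)
    cl′ (a , na) b e = cl a b e , λ z → na (clos cc z a (adj-sym e))
    cxC : Ctx C (c ∷ as) P O []
    cxC = record { fresh = λ z → fresh cx (sub cc z) ; anc = anc cx ; outer = outer cx ; rsub = λ ()
                 ; bd = λ a b e → case bd cx a b e of λ { (inj₁ z) → inj₁ z ; (inj₂ (_ , ())) } }
    cx′ : Ctx (N ∖ C) (c ∷ as) (P ∪ C) O []
    cx′ = record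
      { fresh = λ { (q , nc) (inj₁ z) → fresh cx q z ; (q , nc) (inj₂ z) → nc z }
      ; anc = All.map inj₁ (anc cx) ; outer = λ a b e → inj₁ (outer cx a b e) ; rsub = λ ()
      ; bd = λ { (inj₁ a) b e → case bd cx a (λ z → b (inj₁ z)) e of λ { (inj₁ z) → inj₁ z ; (inj₂ (_ , ())) }
               ; {p} {q} (inj₂ a) b e → case mem? D q of λ
                 { (no nd) → contradiction (inj₁ (outer cx (sp-sub sp (proj₁ (ns (sub cc a)))) nd e)) b
                 ; (yes d) → contradiction (stays a d e) b } } }
      where
      stays : ∀ {p q} → C ∋ p → D ∋ q → Adj G p q → (P ∪ C) ∋ q
      stays {p} {q} a d e with sp-out sp (proj₁ (ns (sub cc a))) d e
      ... | inj₂ m = inj₁ (All.lookup (anc cx) (there m))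
      ... | inj₁ kq with q F.≟ c
      ...   | yes refl = inj₁ (All.lookup (anc cx) (here refl))
      ...   | no ne = inj₂ (clos cm a (kq , ne) e)

  -- The price of one halving of μ: a held run of at most 1 + t² vertices, then after a turn at most
  -- t + t² held vertices and the parent of the next cut subtree.
  q : ℕ
  q = suc (t * t) + suc (t * t + t)

  run-bound : ∀ {K as} m (sp : Sp K as) → Run m sp → m ≤ t * t
  run-bound m sp r with m ≤? t * t
  ... | yes le = le
  ... | no nle = contradiction (run-≤ _ _ sp (≰⇒> nle) r) (no-long-run thin sp)

  smaller : ∀ {K C c f} → K ∋ c → C ⊑ (K ─ c) → cnt K ≤ suc f → cnt C ≤ f
  smaller {K} {C} {c} p s le = ≤-pred (≤-trans (cnt-strict C K (λ z → proj₁ (s z)) p (λ z → proj₂ (s z) refl)) le)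

  child-ctx : ∀ {K as P O} (sp : Sp K as) {c} → K ∋ c → Ctx K as P O [] → Ctx (K ─ c) (c ∷ as) (P ∪ ⟨ c ⟩) (c ∷ O) []
  child-ctx sp {c} p cx = record
    { fresh = λ { (z , ne) (inj₁ y) → fresh cx z y ; (z , ne) (inj₂ y) → ne y }
    ; anc = inj₂ refl ∷ All.map inj₁ (anc cx) ; outer = λ a b e → inj₁ (outer cx a b e) ; rsub = λ ()
    ; bd = λ { (inj₁ a) b e → case bd cx a (λ z → b (inj₁ z)) e of λ { (inj₁ z) → inj₁ (there z) ; (inj₂ (_ , ())) }
             ; (inj₂ refl) b e → inj₁ (here refl) } }

  -- While children other than the last are laid, the run cannot be released and is counted among
  -- the held vertices.
  hold-run : ∀ {K as P O R} → Ctx K as P O R → Ctx K as P (R ++ O) []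
  hold-run {R = R} cx = record { fresh = fresh cx ; anc = anc cx ; outer = outer cx ; rsub = λ ()
    ; bd = λ a b e → inj₁ ([ ∈-++⁺ʳ R , (λ z → ∈-++⁺ˡ (proj₂ z)) ]′ (bd cx a b e)) }

  split-off : ∀ {K P : VS} {c} → K ∋ c → (P ∪ ⟨ c ⟩) ∪ (K ─ c) ⊑ P ∪ K × P ∪ K ⊑ (P ∪ ⟨ c ⟩) ∪ (K ─ c)
  split-off {c = c} p = (λ { (inj₁ (inj₁ z)) → inj₁ z ; (inj₁ (inj₂ refl)) → inj₂ p ; (inj₂ (z , _)) → inj₂ z }) ,
    λ { (inj₁ z) → inj₁ (inj₁ z) ; {v} (inj₂ z) → case v F.≟ c of λ { (yes e) → inj₁ (inj₂ e) ; (no ne) → inj₂ (z , ne) } }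

  -- layH: the heavy child comes last, and the held run R is dropped when this child is a cut subtree.
  -- layL: below a light child everything is held down to a cut subtree at depth t, where the bound on μ has halved.
  layH : ∀ f e {K as P O R} (sp : Sp K as) → Ctx K as P O R → cnt K ≤ f → μ K < 2 ^ suc e → Run (length R ∸ 1) sp →
    length O + q * suc e ≤ W → Ext P (P ∪ K)

  layL : ∀ f e {K as P O τ} b (sp : Sp K as) → Ctx K as P O [] → cnt K ≤ f → Turn e K as τ → Run (length τ ∸ t) sp →
    τ ≢ [] → (∃ λ rest → as ≡ τ ++ rest) → length O ≤ b + length τ → b + suc (t * t + t) + q * e ≤ W → Ext P (P ∪ K)

  layL zero e b sp cx le = contradiction (≤-trans (cnt-inhabited _ (proj₂ (sp-point sp))) le) λ ()
  layL (suc f) e {K} {as} {P} {O} {τ} b sp cx le turn run τ≢ pre lo lw with pick sp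
  ... | c , p , h =
    add c O (fresh cx p) (λ x y z → case bd cx x y z of λ { (inj₁ m) → m ; (inj₂ (_ , ())) }) (≤-trans lo′ (≤-trans (m≤m+n _ (q * e)) (≤-trans (+-monoˡ-≤ (q * e) (+-monoʳ-≤ b (n≤1+n _))) lw)))
      (ext-to (proj₁ (split-off {K} {P} p)) (proj₂ (split-off {K} {P} p))
        (sweep sp p (suc f) (K ─ c) (P ∪ ⟨ c ⟩) go id (λ _ b _ → b) (≤-trans (cnt-mono (K ─ c) K proj₁) le) (child-ctx sp p cx)))
    where
    τb : length τ ≤ t * t + t
    -- The first t levels after the turn are free; beyond them each level extends a run of subtrees
    -- that are not cut, of length at most t².
    τb = ≤-trans (m≤n+m∸n (length τ) t) (≤-trans (+-monoʳ-≤ t (run-bound _ sp run)) (≤-reflexive (+-comm t (t * t))))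
    lo′ : length O ≤ b + (t * t + t)
    lo′ = ≤-trans lo (+-monoʳ-≤ b τb)
    go : ∀ {C P′} → Comp (K ─ c) C → C ⊑ (K ─ c) → Ctx C (c ∷ as) P′ (c ∷ O) [] → Ext P′ (P′ ∪ C)
    go {C} cc s cx′ = case any? (touch? C) as of λ
      { (yes a) → layL f e b sp′ cx′ sm turn′ (ru a) (λ ()) pre′ lo″ lw
      -- A cut subtree is used only from depth t on, where μ has halved; above that depth no run is
      -- recorded.
      ; (no ¬a) → case t ≤? suc (length τ) of λ
        { (no ¬le) → layL f e b sp′ cx′ sm turn′ (subst (λ m → Run m sp′) (symm (m≤n⇒m∸n≡0 (<⇒≤ (≰⇒> ¬le)))) tt) (λ ()) pre′ lo″ lw
        ; (yes far) → deep e sp′ ¬a (proj₂ pre) (turn-far sp′ turn′ far) (≤-trans (+-monoˡ-≤ (q * e) (≤-trans (s≤s lo′) (≤-reflexive (symm (+-suc b _))))) lw) cx′ } }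
      where
      sp′ = down sp c p h cc
      sm = smaller {K} {C} p s le
      turn′ = turn-down sp p h (λ z → proj₁ (s z)) turn
      pre′ : ∃ λ rest → c ∷ as ≡ c ∷ τ ++ rest
      pre′ = proj₁ pre , cong (c ∷_) (proj₂ pre)
      lo″ : length (c ∷ O) ≤ b + length (c ∷ τ)
      lo″ = ≤-trans (s≤s lo) (≤-reflexive (symm (+-suc b (length τ))))
      ru : Any (Touch C) as → Run (suc (length τ) ∸ t) sp′
      ru a with t ≤? length τ
      ... | yes z = subst (λ m → Run m sp′) (symm (+-∸-assoc 1 z)) (a , run)
      ... | no z = subst (λ m → Run m sp′) (symm (m≤n⇒m∸n≡0 (≰⇒> z))) tt
      deep : ∀ e {as rest P′} (sp : Sp C (c ∷ as)) → ¬ Any (Touch C) as → as ≡ τ ++ rest → μ C < 2 ^ e → length (c ∷ O) + q * e ≤ W →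
        Ctx C (c ∷ as) P′ (c ∷ O) [] → Ext P′ (P′ ∪ C)
      -- `cut-μ` needs an ancestor above the parent c, and one exists since τ is not empty.
      deep e {[]} sp _ eq _ _ _ = contradiction (empty τ eq) τ≢
        where
        empty : ∀ (τ : List V) {rest} → [] ≡ τ ++ rest → τ ≡ []
        empty [] _ = refl
        empty (_ ∷ _) ()
      -- The recursion ends here: μ C < 1, whereas `cut-μ` provides an outside neighbour.
      deep zero {_ ∷ _} sp ¬a _ lt _ _ = contradiction (≤-trans (s≤s (cut-μ sp ¬a)) lt) λ { (s≤s ()) }
      deep (suc e) sp ¬a _ lt lw cx′ = layH f e sp cx′ sm lt tt lw

  layH zero e sp cx le = contradiction (≤-trans (cnt-inhabited _ (proj₂ (sp-point sp))) le) λ ()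
  layH (suc f) e {K} {as} {P} {O} {R} sp cx le lt run lw with pick sp
  ... | c , p , h = add c (R ++ O) (fresh cx p) (λ x y z → case bd (hold-run cx) x y z of λ { (inj₁ m) → m ; (inj₂ (_ , ())) }) hold≤ children
    where
    P₁ = P ∪ ⟨ c ⟩
    M = K ─ c
    cx₁ : Ctx M (c ∷ as) P₁ (c ∷ R ++ O) []
    cx₁ = child-ctx sp p (hold-run cx)
    b = length R + length O
    Rb : length R ≤ suc (t * t)
    Rb = ≤-trans (m≤n+m∸n (length R) 1) (s≤s (run-bound _ sp run))
    lw′ : b + suc (t * t + t) + q * e ≤ W
    lw′ = begin
      length R + length O + suc (t * t + t) + q * e ≤⟨ +-monoˡ-≤ (q * e) (+-monoˡ-≤ (suc (t * t + t)) (+-monoˡ-≤ (length O) Rb)) ⟩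
      suc (t * t) + length O + suc (t * t + t) + q * e ≡⟨ cong (λ z → z + suc (t * t + t) + q * e) (+-comm (suc (t * t)) (length O)) ⟩
      length O + suc (t * t) + suc (t * t + t) + q * e ≡⟨ cong (_+ q * e) (+-assoc (length O) (suc (t * t)) (suc (t * t + t))) ⟩
      length O + q + q * e ≡⟨ +-assoc (length O) q (q * e) ⟩
      length O + (q + q * e) ≡⟨ cong (length O +_) (symm (*-suc q e)) ⟩
      length O + q * suc e ≤⟨ lw ⟩
      W ∎
      where open ≤-Reasoning
    hold≤ : length (R ++ O) ≤ W
    hold≤ = ≤-trans (≤-reflexive (length-++ R)) (≤-trans (≤-trans (m≤m+n b (suc (t * t + t))) (m≤m+n _ (q * e))) lw′)
    lo : length (c ∷ R ++ O) ≤ b + 1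
    lo = ≤-reflexive (trans (cong suc (length-++ R)) (+-comm 1 b))
    1∸t : 1 ∸ t ≡ 0
    1∸t = m≤n⇒m∸n≡0 (≤-trans (s≤s z≤n) 3≤t)
    turnAt : ∀ {C P′} (cc : Comp M C) → Turn e C (c ∷ as) (c ∷ []) → Ctx C (c ∷ as) P′ (c ∷ R ++ O) [] → Ext P′ (P′ ∪ C)
    turnAt {C} cc tu cx′ = layL f e b sp′ cx′ (smaller {K} {C} p (sub cc) le) tu (subst (λ m → Run m sp′) (symm 1∸t) tt) (λ ()) (_ , refl) lo lw′
      where sp′ = down sp c p h cc
    children : Ext P₁ (P ∪ K)
    children with heavy? M e
    ... | inj₂ all-light = ext-to (proj₁ (split-off {K} {P} p)) (proj₂ (split-off {K} {P} p))
          (sweep sp p (suc f) M P₁ (λ cc _ cx′ → turnAt cc (light (all-light cc)) cx′) id (λ _ b _ → b) (≤-trans (cnt-mono M K proj₁) le) cx₁)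
    -- The siblings of H are laid first. For each of them H is the witness that μ halves at depth t,
    -- with K in the role of K⁺.
    ... | inj₁ (H , hc , hμ) =
          ext-to (λ { (inj₁ (inj₁ z)) → proj₁ (split-off {K} {P} p) (inj₁ z) ; (inj₁ (inj₂ (z , _))) → proj₁ (split-off {K} {P} p) (inj₂ z) ; (inj₂ z) → inj₂ (proj₁ (sub hc z)) })
            (λ z → case proj₂ (split-off {K} {P} p) z of λ { (inj₁ y) → inj₁ (inj₁ y) ; (inj₂ y) → case mem? H _ of λ { (yes x) → inj₂ x ; (no x) → inj₁ (inj₂ (y , x)) } })
            (sweep sp p (suc f) N P₁ side proj₁ ncl (≤-trans (cnt-mono N K (λ z → proj₁ (proj₁ z))) le) cxN
              ▷ heavyChild (any? (touch? H) as))
      where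
      N = M ∖ H
      P₂ = P₁ ∪ N
      ncl : Closed M N
      ncl (a , na) b e = b , λ z → na (clos hc z a (adj-sym e))
      cxN : Ctx N (c ∷ as) P₁ (c ∷ R ++ O) []
      cxN = record { fresh = λ z → fresh cx₁ (proj₁ z) ; anc = anc cx₁ ; outer = outer cx₁ ; rsub = λ ()
                   ; bd = λ x y z → case bd cx₁ x y z of λ { (inj₁ m) → inj₁ m ; (inj₂ (_ , ())) } }
      side : ∀ {C P′} → Comp M C → C ⊑ N → Ctx C (c ∷ as) P′ (c ∷ R ++ O) [] → Ext P′ (P′ ∪ C)
      side {C} cc s cx′ = turnAt cc (heavy H K refl stop (comp-touch (sp-conn sp) p hc) (conn hc) (λ z → sp-sub sp (proj₁ (sub hc z)))
        (λ { z (here refl) → proj₂ (sub hc z) refl }) (λ z y → proj₂ (s y) z) hμ (λ z → proj₁ (sub cc z)) (λ z → proj₁ (sub hc z)) lt) cx′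
      spH = down sp c p h hc
      remaining : ∀ {v} → K ∋ v → ¬ (P₂ ∋ v) → H ∋ v
      remaining {v} z n with v F.≟ c
      ... | yes refl = contradiction (inj₁ (inj₂ refl)) n
      ... | no ne with mem? H v
      ...   | yes y = y
      ...   | no y = contradiction (inj₂ ((z , ne) , y)) n
      into : ∀ {x y} → K ∋ x → ¬ (P₂ ∋ y) → Adj G x y → H ∋ y
      into {x} {y} kx ny a with mem? D y
      ... | no nd = contradiction (inj₁ (inj₁ (outer cx (sp-sub sp kx) nd a))) ny
      ... | yes d with sp-out sp kx d a
      ...   | inj₁ z = remaining z ny
      ...   | inj₂ m = contradiction (inj₁ (inj₁ (All.lookup (anc cx) m))) ny
      ctxH : ∀ R′ → (∀ {v} → v ∈ R′ → v ∈ c ∷ as) → c ∈ R′ → (∀ {x y} → H ∋ y → x ∈ R → Adj G x y → x ∈ R′) → Ctx H (c ∷ as) P₂ O R′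
      ctxH R′ rs cR keep = record
        { fresh = λ { z (inj₁ (inj₁ y)) → fresh cx (proj₁ (sub hc z)) y ; z (inj₁ (inj₂ y)) → proj₂ (sub hc z) y ; z (inj₂ y) → proj₂ y z }
        ; anc = inj₁ (inj₂ refl) ∷ All.map (λ z → inj₁ (inj₁ z)) (anc cx)
        ; outer = λ a b e → inj₁ (inj₁ (outer cx a b e)) ; rsub = rs
        ; bd = λ { (inj₁ (inj₁ x)) y a → case bd cx x (λ z → y (inj₁ (inj₁ z))) a of λ
                     { (inj₁ z) → inj₁ z ; (inj₂ (kq , z)) → inj₂ (remaining kq y , keep (remaining kq y) z a) }
                 ; (inj₁ (inj₂ refl)) y a → inj₂ (into p y a , cR)
                 ; (inj₂ (x , nx)) y a → contradiction (clos hc (into (proj₁ x) y a) x (adj-sym a)) nx } }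
      heavyChild : Dec (Any (Touch H) as) → Ext P₂ (P₂ ∪ H)
      heavyChild (yes a) = layH f e spH (ctxH (c ∷ R) (λ { (here e) → here e ; (there z) → there (rsub cx z) }) (here refl) (λ _ z _ → there z))
        (smaller {K} {H} p (sub hc) le) (≤-trans (s≤s (μ-mono H K (λ z → proj₁ (sub hc z)))) lt) (ru R run) lw
        where
        -- The oldest vertex of R is where the run began; the subtree below it need not touch a
        -- further ancestor, hence the `∸ 1`.
        ru : ∀ (R : List V) → Run (length R ∸ 1) sp → Run (length R) spH
        ru [] _ = tt
        ru (_ ∷ _) r = a , r
      -- R consists of ancestors, none of which H touches, so c alone replaces it.
      heavyChild (no ¬a) = layH f e spH (ctxH (c ∷ []) (λ { (here e) → here e }) (here refl)
          (λ {x} {y} hy xr e → contradiction (lose (rsub cx xr) (y , hy , adj-sym e)) ¬a))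
        (smaller {K} {H} p (sub hc) le) (≤-trans (s≤s (μ-mono H K (λ z → proj₁ (sub hc z)))) lt) tt lw

  -- The cost of D is O(t²) held vertices for each factor two in the size of the held boundary O.
  layComponent : ∀ e {P O} → (∀ {v} → D ∋ v → ¬ (P ∋ v)) → (∀ {a b} → D ∋ a → ¬ (D ∋ b) → Adj G a b → P ∋ b) →
    Bd P O → (∃ λ v → D ∋ v) → length O < 2 ^ suc e → length O + q * suc e ≤ W → Ext P (P ∪ D)
  layComponent e {P} {O} fr out bd (v , d) lt lw =
    layH (cnt D) e {R = []} (root whole) (record { fresh = fr ; anc = [] ; outer = out ; rsub = λ () ; bd = λ a b e → inj₁ (bd a b e) }) ≤-refl
      (≤-trans (s≤s (cnt-list (Nb D) O (λ { (nd , _ , a , da , e) → bd (out da nd e) (fr da) (adj-sym e) }))) lt) tt lw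
    where
    whole : Comp D D
    whole = record { sub = id ; point = v ; point∈ = d ; conn = D-conn ; clos = λ _ b _ → b }

-- Separation from connectivity, and the base formed by a maximal family of disjoint long cycles.

module Bases {n : ℕ} (G : Graph n) (t : ℕ) (3≤t : 3 ≤ t) where

  open Cycles G t 3≤t public

  separation : ∀ k → KConnected (k + 1) G → ∀ (l : List V) → length l ≤ k → ∀ {u v} → u ∉ l → v ∉ l → Walk (all ∖ lst l) u v
  separation k (_ , c) l le {u} {v} nu nv =
    go nu (c (toSubset (_∈? l)) (subst (∣ toSubset (_∈? l) ∣ <_) (+-comm 1 k)
      (s≤s (≤-trans (∣∣≤length _ l (toSubset⁻ (_∈? l))) le))) u v (λ z → nu (toSubset⁻ (_∈? l) z)) (λ z → nv (toSubset⁻ (_∈? l) z)))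
    where
    go : ∀ {u} → u ∉ l → Reach G (toSubset (_∈? l)) u v → Walk (all ∖ lst l) u v
    go nu here = [] (tt , nu)
    go nu (step a nw r) = ((tt , nu) , a) ∷ go (λ z → nw (toSubset⁺ (_∈? l) z)) r

  -- The list is a concatenation of b paths of G, with `new` marking the borders. Each cycle of the
  -- base becomes one path, its closing edge being forgotten.
  data Pieces : ℕ → List V → Set where
    []   : Pieces 0 []
    new  : ∀ x {b l} → Pieces b l → Pieces (suc b) (x ∷ l)
    link : ∀ {x y b l} → Adj G x y → Pieces b (y ∷ l) → Pieces b (x ∷ y ∷ l)

  pieces-++ : ∀ {b m z} x l → Linked (Adj G) ((x ∷ l) ∷ʳ z) → Pieces b m → Pieces (suc b) ((x ∷ l) ++ m)
  pieces-++ x [] _ p = new x p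
  pieces-++ x (y ∷ l) (a ∷ c) p = link a (pieces-++ y l c p)

  record Base (k : ℕ) : Set where
    field
      bs     : List V
      bs-uniq : Unique bs
      {b}    : ℕ
      pieces : Pieces b bs
      b≤k    : b ≤ k
      bs-hit : ¬ Long (all ∖ lst bs)

  -- Long cycles are collected greedily. The k-th one would complete a packing, so the collection
  -- stops earlier, with no long cycle left off the base.
  base : ∀ k → ¬ Pack k (λ _ → ⊤) → Base k
  base k np = go k 0 [] [] [] tt (+-identityʳ k)
    where
    go : ∀ r m (bs : List V) → Unique bs → Pieces m bs → Pack m (_∈ bs) → r + m ≡ k → Base k
    go zero m bs u p q refl = contradiction (pack-mono m (λ _ → tt) q) np
    go (suc r) m bs u p q e with long? (all ∖ lst bs)
    ... | no nl = record { bs = bs ; bs-uniq = u ; pieces = p ; b≤k = subst (m ≤_) e (m≤n+m m (suc r)) ; bs-hit = nl }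
    ... | yes (x ∷ l , c@(_ , ul , cl) , a) =
      go r (suc m) ((x ∷ l) ++ bs) (Uniq.++⁺ ul u (λ { (y , z) → proj₂ (All.lookup a y) z })) (pieces-++ x l cl p)
        (x ∷ l , c , All.tabulate ∈-++⁺ˡ , pack-mono m (λ z → ∈-++⁺ʳ (x ∷ l) z , λ y → proj₂ (All.lookup a y) z) q)
        (trans (+-suc r m) e)

-- Positions and distances along the base.

module Indices {n : ℕ} (t : ℕ) (bs : List (Fin n)) where

  open Sets n

  idx : List V → V → ℕ
  idx [] v = 0
  idx (x ∷ l) v with x F.≟ v
  ... | yes _ = 0
  ... | no _ = suc (idx l v)

  idx-split : ∀ xs {a ys} → Unique (xs ++ a ∷ ys) → idx (xs ++ a ∷ ys) a ≡ length xs
  idx-split [] {a} u with a F.≟ a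
  ... | yes _ = refl
  ... | no ne = contradiction refl ne
  idx-split (x ∷ xs) {a} (ne ∷ u) with x F.≟ a
  ... | yes refl = contradiction refl (All.lookup ne (∈-++⁺ʳ xs (here refl)))
  ... | no _ = cong suc (idx-split xs u)

  -- Distance below t in the list, measured across the borders of pieces as well; two strict
  -- inequalities avoid truncated subtraction.
  Near : V → V → Set
  Near u v = idx bs u < idx bs v + t × idx bs v < idx bs u + t

  near? : ∀ u v → Dec (Near u v)
  near? u v = (suc (idx bs u) ≤? idx bs v + t) ×-dec (suc (idx bs v) ≤? idx bs u + t)

  near-sym : ∀ {u v} → Near u v → Near v u
  near-sym (a , b) = b , a

  near-refl : 3 ≤ t → ∀ u → Near u u
  near-refl 3≤t u = p , p where p = m<m+n (idx bs u) (≤-trans (s≤s z≤n) 3≤t)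

  ∈-window : ∀ l a w {v} → v ∈ l → a ≤ idx l v → idx l v < a + w → v ∈ take w (drop a l)
  ∈-window (x ∷ l) a w {v} m lo hi with x F.≟ v
  ∈-window (x ∷ l) zero (suc w) m lo hi | yes refl = here refl
  ∈-window (x ∷ l) a w (here refl) lo hi | no ne = contradiction refl ne
  ∈-window (x ∷ l) zero (suc w) (there m) lo (s≤s hi) | no ne = there (∈-window l zero w m z≤n hi)
  ∈-window (x ∷ l) (suc a) w (there m) (s≤s lo) (s≤s hi) | no ne = ∈-window l a w m lo hi

  window : V → List V
  window u = take (t + t) (drop (idx bs u ∸ t) bs)

  near-window : ∀ {u v} → v ∈ bs → Near u v → v ∈ window u
  near-window {u} {v} m (a , b) = ∈-window bs (idx bs u ∸ t) (t + t) m
    (≤-trans (∸-monoˡ-≤ t (<⇒≤ a)) (≤-reflexive (m+n∸n≡m (idx bs v) t)))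
    (≤-trans b (≤-trans (+-monoˡ-≤ t (≤-trans (m≤n+m∸n (idx bs u) t) (≤-reflexive (+-comm t _)))) (≤-reflexive (+-assoc (idx bs u ∸ t) t t))))

  length-window : ∀ u → length (window u) ≤ t + t
  length-window u = ≤-trans (≤-reflexive (length-take (t + t) (drop (idx bs u ∸ t) bs))) (m⊓n≤m _ _)

-- Pairwise relations, counting and concatenation for lists.

module MoreLists where

  allPairs-lookup : ∀ {A : Set} {R : A → A → Set} {xs : List A} → AllPairs R xs →
    ∀ i j → Data.Fin._<_ i j → R (lookup xs i) (lookup xs j)
  allPairs-lookup (r ∷ _) zero (suc j) _ = All.lookup r (∈-lookup j)
  allPairs-lookup (_ ∷ rs) (suc i) (suc j) (s≤s lt) = allPairs-lookup rs i j lt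

  allPairs-∈ : ∀ {A : Set} {R : A → A → Set} {xs : List A} → (∀ {x y} → R x y → R y x) → AllPairs R xs →
    ∀ {x y} → x ∈ xs → y ∈ xs → x ≡ y ⊎ R x y
  allPairs-∈ s (r ∷ rs) (here refl) (here refl) = inj₁ refl
  allPairs-∈ s (r ∷ rs) (here refl) (there q) = inj₂ (All.lookup r q)
  allPairs-∈ s (r ∷ rs) (there p) (here refl) = inj₂ (s (All.lookup r p))
  allPairs-∈ s (r ∷ rs) (there p) (there q) = allPairs-∈ s rs p q

  filter-∪-length : ∀ {A : Set} {P Q R : A → Set} (P? : ∀ x → Dec (P x)) (Q? : ∀ x → Dec (Q x)) (R? : ∀ x → Dec (R x)) →
    (∀ x → P x → Q x ⊎ R x) → ∀ xs → length (filter P? xs) ≤ length (filter Q? xs) + length (filter R? xs)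
  filter-∪-length P? Q? R? s [] = z≤n
  filter-∪-length P? Q? R? s (x ∷ xs) with P? x | Q? x | R? x | filter-∪-length P? Q? R? s xs
  ... | no _ | no _ | no _ | ih = ih
  ... | no _ | no _ | yes _ | ih = ≤-trans ih (+-monoʳ-≤ (length (filter Q? xs)) (n≤1+n _))
  ... | no _ | yes _ | no _ | ih = ≤-trans ih (n≤1+n _)
  ... | no _ | yes _ | yes _ | ih = ≤-trans ih (≤-trans (n≤1+n _) (s≤s (+-monoʳ-≤ (length (filter Q? xs)) (n≤1+n _))))
  ... | yes p | yes _ | no _ | ih = s≤s ih
  ... | yes p | yes _ | yes _ | ih = s≤s (≤-trans ih (+-monoʳ-≤ (length (filter Q? xs)) (n≤1+n _)))
  ... | yes p | no _ | yes _ | ih = ≤-trans (s≤s ih) (≤-reflexive (symm (+-suc (length (filter Q? xs)) _)))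
  ... | yes p | no nq | no nr | ih = contradiction (s x p) [ nq , nr ]′

  concat-infix : ∀ {A : Set} (css : List (List A)) i → Σ (List A) λ ps → Σ (List A) λ qs → concat css ≡ ps ++ lookup css i ++ qs
  concat-infix (c ∷ css) zero = [] , concat css , refl
  concat-infix (c ∷ css) (suc i) with concat-infix css i
  ... | ps , qs , e = c ++ ps , qs , trans (cong (c ++_) e) (symm (++-assoc c ps _))

  concat-∈ : ∀ {A : Set} (css : List (List A)) {v} i → v ∈ lookup css i → v ∈ concat css
  concat-∈ (c ∷ css) zero m = ∈-++⁺ˡ m
  concat-∈ (c ∷ css) (suc i) m = ∈-++⁺ʳ c (concat-∈ css i m)

  concat-cover : ∀ {A : Set} (css : List (List A)) {v} → v ∈ concat css → ∃ λ i → v ∈ lookup css i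
  concat-cover (c ∷ css) m with ∈-++⁻ c m
  ... | inj₁ q = zero , q
  ... | inj₂ q = let i , r = concat-cover css q in suc i , r

  unique-++-disjoint : ∀ {A : Set} (xs : List A) {ys v} → Unique (xs ++ ys) → v ∈ xs → v ∈ ys → ⊥
  unique-++-disjoint (x ∷ xs) (r ∷ u) (here refl) q = All.lookup r (∈-++⁺ʳ xs q) refl
  unique-++-disjoint (x ∷ xs) (r ∷ u) (there p) q = unique-++-disjoint xs u p q

  unique-++ʳ : ∀ {A : Set} (xs : List A) {ys} → Unique (xs ++ ys) → Unique ys
  unique-++ʳ [] u = u
  unique-++ʳ (x ∷ xs) (_ ∷ u) = unique-++ʳ xs u

  concat-disjoint : ∀ {A : Set} (css : List (List A)) {v} → Unique (concat css) → ∀ i j → v ∈ lookup css i → v ∈ lookup css j → i ≡ j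
  concat-disjoint (c ∷ css) u zero zero p q = refl
  concat-disjoint (c ∷ css) u zero (suc j) p q = ⊥-elim (unique-++-disjoint c u p (concat-∈ css j q))
  concat-disjoint (c ∷ css) u (suc i) zero p q = ⊥-elim (unique-++-disjoint c u q (concat-∈ css i p))
  concat-disjoint (c ∷ css) u (suc i) (suc j) p q = cong suc (concat-disjoint css (unique-++ʳ c u) i j p q)

open MoreLists public

-- Ears of the base, the cutting of the base into chunks, and packings found among ears.

module Ears {n : ℕ} (G : Graph n) (t : ℕ) (3≤t : 3 ≤ t) (bs : List (Fin n)) (bs-uniq : Unique bs) where

  open Bases G t 3≤t public
  open Indices t bs public

  -- The inside of an ear, so that chords of the base and paths off the base are treated alike.
  data Mid (u v : V) : List V → Set where
    chord : Adj G u v → Mid u v []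
    via   : ∀ {a b m} → Adj G u a → Path a b m → Adj G b v → Mid u v m

  mid-sym : ∀ {u v m} → Mid u v m → Mid v u (reverse m)
  mid-sym (chord a) = chord (adj-sym a)
  mid-sym (via a p b) = via (adj-sym b) (reversePath p) (adj-sym a)

  joinMid : ∀ {x u v y l m l′} → Path x u l → Mid u v m → Path v y l′ → Path x y (l ++ m ++ l′)
  joinMid p (chord a) q = joinPath p a q
  joinMid p (via a r b) q = joinPath p a (joinPath r b q)

  closeMid : ∀ {u v l m} {P : V → Set} → Path u v l → Mid v u m → Unique (l ++ m) → All P (l ++ m) → t ≤ length l → LongIn P
  closeMid {l = l} {P = P} p (chord a) u w le = closePath p a (subst Unique (++-identityʳ l) u) (subst (All P) (++-identityʳ l) w) le
  closeMid {l = l} p (via a r b) u w le = closePath (joinPath p a r) b u w (≤-trans le (≤-trans (m≤m+n _ _) (≤-reflexive (symm (length-++ l)))))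

  record BEar : Set where
    field
      u v  : V
      u∈   : u ∈ bs
      v∈   : v ∈ bs
      {mid} : List V
      conn : Mid u v mid
      mid-uniq : Unique mid
      off  : All (_∉ bs) mid
      far  : ¬ Near u v
  open BEar public

  Apart : BEar → BEar → Set
  Apart e f = (∀ {x} → x ∈ mid e → x ∈ mid f → ⊥) × (¬ Near (u e) (u f) × ¬ Near (u e) (v f)) × (¬ Near (v e) (u f) × ¬ Near (v e) (v f))

  apart-sym : ∀ {e f} → Apart e f → Apart f e
  apart-sym (d , (a , b) , (c , e)) = (λ x y → d y x) , ((λ z → a (near-sym z)) , λ z → c (near-sym z)) , ((λ z → b (near-sym z)) , λ z → e (near-sym z))

  near≢ : ∀ {x y} → ¬ Near x y → x ≢ y
  near≢ n refl = n (near-refl 3≤t _)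

  linked-drop : ∀ (xs : List V) {ys} → Linked (Adj G) (xs ++ ys) → Linked (Adj G) ys
  linked-drop [] l = l
  linked-drop (x ∷ []) [-] = []
  linked-drop (x ∷ []) (_ ∷ l) = l
  linked-drop (x ∷ y ∷ xs) (_ ∷ l) = linked-drop (y ∷ xs) l

  linked-path : ∀ {a b} m {q} → Linked (Adj G) (a ∷ m ++ b ∷ q) → Path a b (a ∷ m ++ b ∷ [])
  linked-path [] (e ∷ _) = e ∷ stop
  linked-path (x ∷ m) (e ∷ l) = e ∷ linked-path m l

  Segment : List V → V → V → Set
  Segment c a b = Σ (List V) λ l → Path a b l × Unique l × All (_∈ c) l × t ≤ length l

  -- Inside a linked stretch of the base the vertices from a to b form a path; as the positions
  -- differ by at least t, it has more than t vertices, in either order of a and b.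
  segment : ∀ {ps c qs a b} → bs ≡ ps ++ c ++ qs → Linked (Adj G) c → a ∈ c → b ∈ c → ¬ Near a b → Segment c a b
  segment {ps} {c} {qs} {a} {b} eq lk ma mb nn with ∈-∃++ ma
  ... | p₁ , r , refl = case ∈-++⁻ p₁ mb of λ
    { (inj₂ (here refl)) → contradiction (near-refl 3≤t a) nn
    ; (inj₂ (there m)) → case ∈-∃++ m of λ { (m , s , refl) → ordered p₁ m s eq lk nn }
    ; (inj₁ m) → case ∈-∃++ m of λ { (p₀ , m , refl) →
        case ordered p₀ m r (trans eq (cong (λ z → ps ++ z ++ qs) (++-assoc p₀ _ _))) (subst (Linked (Adj G)) (++-assoc p₀ _ _) lk) (λ z → nn (near-sym z)) of λ
          { (l , p , uq , w , le) → reverse l , reversePath p , unique-reverse uq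
              , all-reverse (subst (λ z → All (_∈ z) l) (symm (++-assoc p₀ _ _)) w) , ≤-trans le (≤-reflexive (symm (length-reverse l))) } } }
    where
    ordered : ∀ {a b} p m s → bs ≡ ps ++ (p ++ a ∷ m ++ b ∷ s) ++ qs → Linked (Adj G) (p ++ a ∷ m ++ b ∷ s) → ¬ Near a b →
      Segment (p ++ a ∷ m ++ b ∷ s) a b
    ordered {a} {b} p m s eq lk nn = a ∷ m ++ b ∷ [] , linked-path m (linked-drop p lk) ,
      unique-++ˡ (a ∷ m ++ b ∷ []) (subst Unique (cong (a ∷_) (symm (++-assoc m (b ∷ []) (s ++ qs)))) uq₂) , wi , le
      where
      full : bs ≡ (ps ++ p) ++ a ∷ m ++ b ∷ s ++ qs
      full = trans eq (trans (cong (ps ++_) (trans (++-assoc p (a ∷ m ++ b ∷ s) qs) (cong (λ z → p ++ a ∷ z) (++-assoc m (b ∷ s) qs)))) (symm (++-assoc ps p _)))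
      uq₁ : Unique ((ps ++ p) ++ a ∷ m ++ b ∷ s ++ qs)
      uq₁ = subst Unique full bs-uniq
      uq₂ : Unique (a ∷ m ++ b ∷ s ++ qs)
      uq₂ = unique-++ʳ (ps ++ p) uq₁
      wi : All (_∈ p ++ a ∷ m ++ b ∷ s) (a ∷ m ++ b ∷ [])
      wi = All.tabulate λ {x} z → ∈-++⁺ʳ p (subst (x ∈_) (cong (a ∷_) (++-assoc m (b ∷ []) s)) (∈-++⁺ˡ z))
      ia : idx bs a ≡ length (ps ++ p)
      ia = trans (cong (λ z → idx z a) full) (idx-split (ps ++ p) uq₁)
      full′ : (ps ++ p) ++ a ∷ m ++ b ∷ s ++ qs ≡ ((ps ++ p) ++ a ∷ m) ++ b ∷ s ++ qs
      full′ = symm (++-assoc (ps ++ p) (a ∷ m) (b ∷ s ++ qs))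
      ib : idx bs b ≡ length (ps ++ p) + suc (length m)
      ib = trans (cong (λ z → idx z b) (trans full full′)) (trans (idx-split ((ps ++ p) ++ a ∷ m) (subst Unique full′ uq₁)) (length-++ (ps ++ p)))
      le : t ≤ length (a ∷ m ++ b ∷ [])
      le with t ≤? suc (length m)
      ... | yes z = ≤-trans z (s≤s (≤-trans (m≤m+n (length m) 1) (≤-reflexive (symm (length-++ m)))))
      ... | no z = contradiction (lt₁ , lt₂) nn
        where
        lt₁ : idx bs a < idx bs b + t
        lt₁ = ≤-trans (s≤s (≤-trans (≤-reflexive ia) (≤-trans (m≤m+n _ _) (≤-reflexive (symm ib))))) (m<m+n _ (≤-trans (s≤s z≤n) 3≤t))
        lt₂ : idx bs b < idx bs a + t
        lt₂ = subst₂ _<_ (symm ib) (cong (_+ t) (symm ia)) (+-monoʳ-< (length (ps ++ p)) (≰⇒> z))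

  module Chunking (E : List V) (β : ℕ) (1≤β : 1 ≤ β) where

    ends : List V → ℕ
    ends l = length (filter (_∈? E) l)

    ends-∷ : ∀ x l → ends (x ∷ l) ≡ ends (x ∷ []) + ends l
    ends-∷ x l with x ∈? E
    ... | yes _ = refl
    ... | no _ = refl

    ends-one : ∀ x → ends (x ∷ []) ≤ 1
    ends-one x with x ∈? E
    ... | yes _ = ≤-refl
    ... | no _ = z≤n

    Chunk : List V → Set
    Chunk c = Linked (Adj G) c × ends c ≤ β

    -- Greedy chunks, read from the right; the first chunk is the only one that need neither be full nor end a piece.
    record Chunks (b : ℕ) (x : V) (l : List V) : Set where
      field
        c   : List V
        cs  : List (List V)
        cat : c ++ concat cs ≡ l
        ok  : All Chunk ((x ∷ c) ∷ cs)
        few : β * suc (length cs) + ends (x ∷ c) ≤ β * b + ends (x ∷ l)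

    single : ∀ x → Chunk (x ∷ [])
    single x = [-] , ≤-trans (ends-one x) 1≤β

    -- A new chunk is begun at a border, paid for by the piece, or when one more vertex would exceed
    -- β ends, paid for by the β ends already in the chunk being closed.
    chunks : ∀ {b x l} → Pieces b (x ∷ l) → Chunks b x l
    chunks (new x []) = record { c = [] ; cs = [] ; cat = refl ; ok = single x ∷ [] ; few = ≤-refl }
    chunks (new x {b} {y ∷ l} p) = record { c = [] ; cs = (y ∷ c) ∷ cs ; cat = cong (y ∷_) cat ; ok = single x ∷ ok ; few = bound }
      where
      open Chunks (chunks p)
      open ≤-Reasoning
      bound : β * suc (suc (length cs)) + ends (x ∷ []) ≤ β * suc b + ends (x ∷ y ∷ l)
      bound = begin
        β * suc (suc (length cs)) + ends (x ∷ []) ≡⟨ cong (_+ ends (x ∷ [])) (*-suc β (suc (length cs))) ⟩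
        β + β * suc (length cs) + ends (x ∷ []) ≤⟨ +-monoˡ-≤ (ends (x ∷ [])) (+-monoʳ-≤ β (≤-trans (m≤m+n _ (ends (y ∷ c))) few)) ⟩
        β + (β * b + ends (y ∷ l)) + ends (x ∷ []) ≡⟨ cong (_+ ends (x ∷ [])) (symm (+-assoc β (β * b) (ends (y ∷ l)))) ⟩
        β + β * b + ends (y ∷ l) + ends (x ∷ []) ≡⟨ +-assoc (β + β * b) (ends (y ∷ l)) (ends (x ∷ [])) ⟩
        β + β * b + (ends (y ∷ l) + ends (x ∷ [])) ≡⟨ cong₂ _+_ (symm (*-suc β b)) (trans (+-comm (ends (y ∷ l)) _) (symm (ends-∷ x (y ∷ l)))) ⟩
        β * suc b + ends (x ∷ y ∷ l) ∎
    chunks (link {x} {y} {b} {l} a p) = extend (ends (x ∷ y ∷ c) ≤? β)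
      where
      open Chunks (chunks p)
      open ≤-Reasoning
      extend : Dec (ends (x ∷ y ∷ c) ≤ β) → Chunks b x (y ∷ l)
      extend (yes le) with ok
      ... | (lk , _) ∷ oks = record { c = y ∷ c ; cs = cs ; cat = cong (y ∷_) cat ; ok = (a ∷ lk , le) ∷ oks ; few = begin
        β * suc (length cs) + ends (x ∷ y ∷ c) ≡⟨ cong (β * suc (length cs) +_) (trans (ends-∷ x (y ∷ c)) (+-comm (ends (x ∷ [])) _)) ⟩
        β * suc (length cs) + (ends (y ∷ c) + ends (x ∷ [])) ≡⟨ symm (+-assoc (β * suc (length cs)) (ends (y ∷ c)) (ends (x ∷ []))) ⟩
        β * suc (length cs) + ends (y ∷ c) + ends (x ∷ []) ≤⟨ +-monoˡ-≤ (ends (x ∷ [])) few ⟩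
        β * b + ends (y ∷ l) + ends (x ∷ []) ≡⟨ +-assoc (β * b) _ _ ⟩
        β * b + (ends (y ∷ l) + ends (x ∷ [])) ≡⟨ cong (β * b +_) (trans (+-comm (ends (y ∷ l)) _) (symm (ends-∷ x (y ∷ l)))) ⟩
        β * b + ends (x ∷ y ∷ l) ∎ }
      extend (no nle) = record { c = [] ; cs = (y ∷ c) ∷ cs ; cat = cong (y ∷_) cat ; ok = single x ∷ ok ; few = begin
        β * suc (suc (length cs)) + ends (x ∷ []) ≡⟨ cong (_+ ends (x ∷ [])) (trans (*-suc β (suc (length cs))) (+-comm β _)) ⟩
        β * suc (length cs) + β + ends (x ∷ []) ≤⟨ +-monoˡ-≤ (ends (x ∷ [])) (≤-trans (+-monoʳ-≤ (β * suc (length cs)) full) few) ⟩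
        β * b + ends (y ∷ l) + ends (x ∷ []) ≡⟨ +-assoc (β * b) _ _ ⟩
        β * b + (ends (y ∷ l) + ends (x ∷ [])) ≡⟨ cong (β * b +_) (trans (+-comm (ends (y ∷ l)) _) (symm (ends-∷ x (y ∷ l)))) ⟩
        β * b + ends (x ∷ y ∷ l) ∎ }
        where
        full : β ≤ ends (y ∷ c)
        full = ≤-pred (≤-trans (≰⇒> nle) (≤-trans (≤-reflexive (ends-∷ x (y ∷ c))) (+-monoˡ-≤ (ends (y ∷ c)) (ends-one x))))

    chunkList : ∀ {b l} → Pieces b l → Σ (List (List V)) λ css → concat css ≡ l × All Chunk css × β * length css ≤ β * b + ends l
    chunkList {l = []} _ = [] , refl , [] , ≤-trans (≤-reflexive (*-zeroʳ β)) z≤n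
    chunkList {l = x ∷ l} p = (x ∷ c) ∷ cs , cong (x ∷_) cat , ok , ≤-trans (m≤m+n _ _) few
      where open Chunks (chunks p)

  module Select (css : List (List V)) (cat : concat css ≡ bs) (linked : All (Linked (Adj G)) css)
    (β : ℕ) (E₀ : List V) (sparse : ∀ i → length (filter (_∈? E₀) (lookup css i)) ≤ β) where

    p : ℕ
    p = length css

    ch : Fin p → List V
    ch = lookup css

    ι : ∀ {x} → x ∈ bs → Fin p
    ι m = proj₁ (concat-cover css (subst (_ ∈_) (symm cat) m))

    ι-∈ : ∀ {x} (m : x ∈ bs) → x ∈ ch (ι m)
    ι-∈ m = proj₂ (concat-cover css (subst (_ ∈_) (symm cat) m))

    ch-bs : ∀ i {x} → x ∈ ch i → x ∈ bs
    ch-bs i m = subst (_ ∈_) cat (concat-∈ css i m)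

    ch-same : ∀ i j {x} → x ∈ ch i → x ∈ ch j → i ≡ j
    ch-same i j = concat-disjoint css (subst Unique (symm cat) bs-uniq) i j

    seg : ∀ i {a b} → a ∈ ch i → b ∈ ch i → ¬ Near a b → Segment (ch i) a b
    seg i ma mb nn with concat-infix css i
    ... | ps , qs , e = segment {ps} {ch i} {qs} (trans (symm cat) e) (All.lookup linked (∈-lookup i)) ma mb nn

    ιu ιv : BEar → Fin p
    ιu e = ι (u∈ e)
    ιv e = ι (v∈ e)

    Region : List BEar → V → Set
    Region E x = Σ BEar λ e → e ∈ E × (x ∈ mid e ⊎ x ∈ ch (ιu e) ⊎ x ∈ ch (ιv e))

    Local : BEar → BEar → V → Set
    Local e f x = (x ∈ mid e ⊎ x ∈ mid f) ⊎ (x ∈ ch (ιu e) ⊎ x ∈ ch (ιv e))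

    -- If both ends of e lie in one chunk, e and the stretch between its ends form the cycle.
    -- Otherwise the two ears and the stretches joining their ends in two different chunks do; the
    -- first stretch alone makes the cycle long.
    cycle : ∀ e f → Apart e f → ιu e ≡ ιu f → ιv e ≡ ιv f → LongIn (Local e f)
    cycle e f (dj , (nuu , _) , (_ , nvv)) eu ev with ιu e F.≟ ιv e
    ... | yes same = case seg (ιu e) (ι-∈ (u∈ e)) (subst (λ i → v e ∈ ch i) (symm same) (ι-∈ (v∈ e))) (far e) of λ
      { (l , p , uq , w , le) → closeMid p (mid-sym (conn e))
          (Uniq.++⁺ uq (unique-reverse (mid-uniq e)) λ { (a , b) → All.lookup (off e) (AnyP.reverse⁻ b) (ch-bs _ (All.lookup w a)) })
          (AllP.++⁺ (All.map (λ z → inj₂ (inj₁ z)) w) (all-reverse (All.tabulate λ z → inj₁ (inj₁ z)))) le }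
    ... | no diff = case seg (ιu e) (ι-∈ (u∈ e)) (subst (λ i → u f ∈ ch i) (symm eu) (ι-∈ (u∈ f))) nuu of λ
      { (l₁ , p₁ , u₁ , w₁ , le) → case seg (ιv e) (subst (λ i → v f ∈ ch i) (symm ev) (ι-∈ (v∈ f))) (ι-∈ (v∈ e)) (λ z → nvv (near-sym z)) of λ
      { (l₂ , p₂ , u₂ , w₂ , _) → closeMid (joinMid p₁ (conn f) p₂) (mid-sym (conn e))
          (Uniq.++⁺ (Uniq.++⁺ u₁ (Uniq.++⁺ (mid-uniq f) u₂ λ { (a , b) → All.lookup (off f) a (ch-bs _ (All.lookup w₂ b)) })
              λ { (a , b) → case ∈-++⁻ (mid f) b of λ { (inj₁ c) → All.lookup (off f) c (ch-bs _ (All.lookup w₁ a))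
                                                      ; (inj₂ c) → diff (ch-same _ _ (All.lookup w₁ a) (All.lookup w₂ c)) } })
            (unique-reverse (mid-uniq e))
            λ { (a , b) → case ∈-++⁻ l₁ a of λ
              { (inj₁ c) → All.lookup (off e) (AnyP.reverse⁻ b) (ch-bs _ (All.lookup w₁ c))
              ; (inj₂ c) → case ∈-++⁻ (mid f) c of λ
                { (inj₁ d) → dj (AnyP.reverse⁻ b) d
                ; (inj₂ d) → All.lookup (off e) (AnyP.reverse⁻ b) (ch-bs _ (All.lookup w₂ d)) } } })
          (AllP.++⁺ (AllP.++⁺ (All.map (λ z → inj₂ (inj₁ z)) w₁) (AllP.++⁺ (All.tabulate λ z → inj₁ (inj₂ z)) (All.map (λ z → inj₂ (inj₂ z)) w₂)))
            (all-reverse (All.tabulate λ z → inj₁ (inj₁ z))))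
          (≤-trans le (≤-trans (m≤m+n _ _) (≤-reflexive (symm (length-++ l₁))))) } }

    -- Ears with distinct ends inject into the members of E₀ in the chunk.
    at-chunk : ∀ i (end : BEar → V) (end∈ : ∀ e → end e ∈ bs) {E} → AllPairs (λ e f → end e ≢ end f) E →
      All (λ e → end e ∈ E₀) E → length (filter (λ e → ι (end∈ e) F.≟ i) E) ≤ β
    at-chunk i end end∈ {E} ap inE =
      ≤-trans (≤-trans (≤-reflexive (symm (length-map end F))) (⊆-length uq sb)) (sparse i)
      where
      F = filter (λ e → ι (end∈ e) F.≟ i) E
      uq : Unique (map end F)
      uq = AP.map⁺ (AP.filter⁺ (λ e → ι (end∈ e) F.≟ i) ap)
      sb : ∀ {x} → x ∈ map end F → x ∈ filter (_∈? E₀) (ch i)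
      sb m with ∈-map⁻ end m
      ... | e , me , refl with ∈-filter⁻ (λ e → ι (end∈ e) F.≟ i) {xs = E} me
      ...   | me′ , refl = ∈-filter⁺ (_∈? E₀) (ι-∈ (end∈ e)) (All.lookup inE me′)

    -- By pigeonhole two ears share their pair of chunks and yield a cycle. It meets only those two
    -- chunks, where at most 4β ears end; without these ears the search continues off the cycle.
    select : ∀ j (E : List BEar) → AllPairs Apart E → All (λ e → u e ∈ E₀ × v e ∈ E₀) E → p * p + j * (4 * β) < length E → Pack j (Region E)
    select zero E ap inE lt = tt
    select (suc j) E ap inE lt with F.pigeonhole (≤-trans (s≤s (m≤m+n (p * p) _)) lt) (λ i → combine (ιu (lookup E i)) (ιv (lookup E i)))
    ... | i₁ , i₂ , i₁<i₂ , eq with F.combine-injective (ιu (lookup E i₁)) (ιv (lookup E i₁)) (ιu (lookup E i₂)) (ιv (lookup E i₂)) eq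
    ... | eu , ev with cycle (lookup E i₁) (lookup E i₂) (allPairs-lookup ap i₁ i₂ i₁<i₂) eu ev
    ... | l , lc , w = l , lc , All.map region w , pack-mono j shrink (select j E′ (AP.filter⁺ keep? ap) (All.tabulate (λ m → All.lookup inE (proj₁ (∈-filter⁻ keep? {xs = E} m)))) lt′)
      where
      e = lookup E i₁
      f = lookup E i₂
      c = ιu e
      d = ιv e
      Hits : BEar → Set
      Hits g = (ιu g ≡ c ⊎ ιu g ≡ d) ⊎ (ιv g ≡ c ⊎ ιv g ≡ d)
      hits? : ∀ g → Dec (Hits g)
      hits? g = ((ιu g F.≟ c) ⊎-dec (ιu g F.≟ d)) ⊎-dec ((ιv g F.≟ c) ⊎-dec (ιv g F.≟ d))
      keep? : ∀ g → Dec (¬ Hits g)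
      keep? g = ¬? (hits? g)
      E′ = filter keep? E
      region : ∀ {x} → Local e f x → Region E x
      region (inj₁ (inj₁ m)) = e , ∈-lookup i₁ , inj₁ m
      region (inj₁ (inj₂ m)) = f , ∈-lookup i₂ , inj₁ m
      region (inj₂ m) = e , ∈-lookup i₁ , inj₂ m
      differ : ∀ {g} h → h ∈ E → Hits h → g ∈ E → ¬ Hits g → ∀ {x} → x ∈ mid g → x ∈ mid h → ⊥
      differ {g} h mh hh mg ng a b with allPairs-∈ (λ {x} {y} → apart-sym {x} {y}) ap mg mh
      ... | inj₁ refl = ng hh
      ... | inj₂ r = proj₁ r a b
      apart : ∀ {x g} → g ∈ E → ¬ Hits g → (x ∈ mid g ⊎ x ∈ ch (ιu g) ⊎ x ∈ ch (ιv g)) → Local e f x → ⊥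
      apart mg ng (inj₁ a) (inj₁ (inj₁ b)) = differ e (∈-lookup i₁) (inj₁ (inj₁ refl)) mg ng a b
      apart mg ng (inj₁ a) (inj₁ (inj₂ b)) = differ f (∈-lookup i₂) (inj₁ (inj₁ (symm eu))) mg ng a b
      apart {g = g} mg ng (inj₁ a) (inj₂ (inj₁ b)) = All.lookup (off g) a (ch-bs c b)
      apart {g = g} mg ng (inj₁ a) (inj₂ (inj₂ b)) = All.lookup (off g) a (ch-bs d b)
      apart {g = g} mg ng (inj₂ (inj₁ a)) (inj₁ (inj₁ b)) = All.lookup (off e) b (ch-bs _ a)
      apart {g = g} mg ng (inj₂ (inj₁ a)) (inj₁ (inj₂ b)) = All.lookup (off f) b (ch-bs _ a)
      apart {g = g} mg ng (inj₂ (inj₂ a)) (inj₁ (inj₁ b)) = All.lookup (off e) b (ch-bs _ a)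
      apart {g = g} mg ng (inj₂ (inj₂ a)) (inj₁ (inj₂ b)) = All.lookup (off f) b (ch-bs _ a)
      apart mg ng (inj₂ (inj₁ a)) (inj₂ (inj₁ b)) = ng (inj₁ (inj₁ (ch-same _ _ a b)))
      apart mg ng (inj₂ (inj₁ a)) (inj₂ (inj₂ b)) = ng (inj₁ (inj₂ (ch-same _ _ a b)))
      apart mg ng (inj₂ (inj₂ a)) (inj₂ (inj₁ b)) = ng (inj₂ (inj₁ (ch-same _ _ a b)))
      apart mg ng (inj₂ (inj₂ a)) (inj₂ (inj₂ b)) = ng (inj₂ (inj₂ (ch-same _ _ a b)))
      shrink : ∀ {x} → Region E′ x → Region E x × x ∉ l
      shrink (g , m , r) with ∈-filter⁻ keep? {xs = E} m
      ... | mg , ng = (g , mg , r) , λ z → apart mg ng r (All.lookup w z)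
      uu : AllPairs (λ e f → u e ≢ u f) E
      uu = AllPairs.map (λ { (_ , (a , _) , _) → near≢ a }) ap
      vv : AllPairs (λ e f → v e ≢ v f) E
      vv = AllPairs.map (λ { (_ , _ , (_ , a)) → near≢ a }) ap
      inU = All.map proj₁ inE
      inV = All.map proj₂ inE
      hit-count : length (filter hits? E) ≤ 4 * β
      hit-count = ≤-trans (filter-∪-length hits? hu? hv? (λ _ z → z) E)
        (≤-trans (+-mono-≤ (filter-∪-length hu? (λ g → ιu g F.≟ c) (λ g → ιu g F.≟ d) (λ _ z → z) E) (filter-∪-length hv? (λ g → ιv g F.≟ c) (λ g → ιv g F.≟ d) (λ _ z → z) E))
        (≤-trans (+-mono-≤ (+-mono-≤ (at-chunk c u u∈ uu inU) (at-chunk d u u∈ uu inU)) (+-mono-≤ (at-chunk c v v∈ vv inV) (at-chunk d v v∈ vv inV)))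
          (≤-reflexive (trans (+-assoc β β (β + β)) (cong (λ z → β + (β + (β + z))) (symm (+-identityʳ β)))))))
        where
        hu? = λ g → (ιu g F.≟ c) ⊎-dec (ιu g F.≟ d)
        hv? = λ g → (ιv g F.≟ c) ⊎-dec (ιv g F.≟ d)
      total : length E ≤ length E′ + 4 * β
      total = ≤-trans (≤-reflexive (symm (cong length (filter-all (λ _ → yes tt) {xs = E} (All.tabulate (λ _ → tt))))))
        (≤-trans (filter-∪-length (λ _ → yes tt) keep? hits? (λ g _ → case hits? g of λ { (yes h) → inj₂ h ; (no h) → inj₁ h }) E) (+-monoʳ-≤ (length E′) hit-count))
      lt′ : p * p + j * (4 * β) < length E′
      lt′ = +-cancelʳ-< (4 * β) _ _ (≤-trans (s≤s (≤-reflexive (trans (+-assoc (p * p) (j * (4 * β)) (4 * β)) (cong (p * p +_) (+-comm (j * (4 * β)) (4 * β)))))) (≤-trans lt total))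

-- The numbers for which sufficiently many ears give k disjoint long cycles.

module ManyEars {n : ℕ} (G : Graph n) (t : ℕ) (3≤t : 3 ≤ t) (bs : List (Fin n)) (bs-uniq : Unique bs) where

  open Ears G t 3≤t bs bs-uniq public

  -- Keeping only 600k² ears bounds the ends by 1200k². With β = 75k the chunks number at most k +
  -- 16k = 17k, and (17k)² + k · 4 · 75k = 589k² is below 600k².
  ears-pack : ∀ k → 1 ≤ k → ∀ {b} → Pieces b bs → b ≤ k → (E : List BEar) → AllPairs Apart E → 600 * (k * k) ≤ length E → Pack k (λ _ → ⊤)
  ears-pack k 1≤k {b} ps b≤k E ap many with Chunking.chunkList E₀ β 1≤β ps
    where
    N = 600 * (k * k)
    E₀ = map u (take N E) ++ map v (take N E)
    β = 75 * k
    1≤β = ≤-trans 1≤k (m≤m+n k (74 * k))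
  ... | css , cat , ok , few = pack-mono k (λ _ → tt) (Select.select css cat (All.map proj₁ ok) β E₀ (λ i → proj₂ (All.lookup ok (∈-lookup i)))
      k (take N E) (AP.take⁺ N ap) (All.tabulate λ m → ∈-++⁺ˡ (∈-map⁺ u m) , ∈-++⁺ʳ (map u (take N E)) (∈-map⁺ v m)) enough)
    where
    N = 600 * (k * k)
    E₀ = map u (take N E) ++ map v (take N E)
    β = 75 * k
    instance
      β-nonzero : NonZero β
      β-nonzero = >-nonZero (≤-trans 1≤k (m≤m+n k (74 * k)))
    len : length (take N E) ≡ N
    len = trans (length-take N E) (m≤n⇒m⊓n≡m many)
    len₀ : length E₀ ≡ N + N
    len₀ = trans (length-++ (map u (take N E))) (cong₂ _+_ (trans (length-map u (take N E)) len) (trans (length-map v (take N E)) len))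
    ends≤ : length (filter (_∈? E₀) bs) ≤ N + N
    ends≤ = ≤-trans (⊆-length (Uniq.filter⁺ (_∈? E₀) bs-uniq) (λ m → proj₂ (∈-filter⁻ (_∈? E₀) {xs = bs} m))) (≤-reflexive len₀)
    open ≤-Reasoning
    eq₁ : ∀ k → 75 * k * k + (600 * (k * k) + 600 * (k * k)) ≡ 75 * k * (17 * k)
    eq₁ = solve-∀
    p≤ : length css ≤ 17 * k
    p≤ = *-cancelˡ-≤ β (begin
      β * length css ≤⟨ few ⟩
      β * b + length (filter (_∈? E₀) bs) ≤⟨ +-mono-≤ (*-monoʳ-≤ β b≤k) ends≤ ⟩
      β * k + (N + N) ≡⟨ eq₁ k ⟩
      β * (17 * k) ∎)
    eq₂ : ∀ k → (17 * k) * (17 * k) + k * (4 * (75 * k)) + 11 * (k * k) ≡ 600 * (k * k)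
    eq₂ = solve-∀
    enough : length css * length css + k * (4 * β) < length (take N E)
    enough = begin-strict
      length css * length css + k * (4 * β) ≤⟨ +-monoˡ-≤ _ (*-mono-≤ p≤ p≤) ⟩
      (17 * k) * (17 * k) + k * (4 * β) <⟨ m<m+n _ (≤-trans (*-mono-≤ 1≤k 1≤k) (m≤m+n (k * k) (10 * (k * k)))) ⟩
      (17 * k) * (17 * k) + k * (4 * β) + 11 * (k * k) ≡⟨ eq₂ k ⟩
      N ≡⟨ symm len ⟩
      length (take N E) ∎

-- Deleting a small set X so that the remaining components attach locally to the base.

module Extraction {n : ℕ} (G : Graph n) (t : ℕ) (3≤t : 3 ≤ t) (bs : List (Fin n)) (bs-uniq : Unique bs) (k : ℕ) where

  open ManyEars G t 3≤t bs bs-uniq public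

  S : VS
  S = all ∖ lst bs

  open Spines G t 3≤t S using (Sp; root; down; sp-conn; sp-sub; sp-out; AdjHead; pick; few-touched)

  good : VS → VS
  good K = vs (λ x → x ∈ bs × Long (K ∪ ⟨ x ⟩)) (λ x → (x ∈? bs) ×-dec long? (K ∪ ⟨ x ⟩))

  Big : VS → Set
  Big K = k ≤ cnt (good K)

  Free : List V → V → Set
  Free X v = v ∈ bs × v ∉ X

  NonLocal : List V → VS → Set
  NonLocal X K = ∃ λ u → ∃ λ v → (Free X u × Free X v) × (Touch K u × Touch K v) × ¬ Near u v

  Bad : List V → VS → Set
  Bad X K = NonLocal X K ⊎ Big K

  bad? : ∀ X K → Dec (Bad X K)
  bad? X K = F.any? (λ u → F.any? λ v → ((((u ∈? bs) ×-dec ¬? (u ∈? X)) ×-dec ((v ∈? bs) ×-dec ¬? (v ∈? X))) ×-dec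
    ((touch? K u ×-dec touch? K v) ×-dec ¬? (near? u v)))) ⊎-dec (k ≤? cnt (good K))

  -- A set found not to be bad stays so when X grows or the set shrinks, so verdicts survive later
  -- deletions.
  bad-mono : ∀ {X Y} K L → (∀ {v} → v ∈ X → v ∈ Y) → K ⊑ L → Bad Y K → Bad X L
  bad-mono K L s r (inj₁ (u , v , ((a , b) , (c , d)) , ((x , p , e) , (y , q , f)) , nn)) =
    inj₁ (u , v , ((a , λ z → b (s z)) , (c , λ z → d (s z))) , ((x , r p , e) , (y , r q , f)) , nn)
  bad-mono K L s r (inj₂ le) = inj₂ (≤-trans le (cnt-mono (good K) (good L)
    (λ { (m , c) → m , long-mono (λ { (inj₁ z) → inj₁ (r z) ; (inj₂ z) → inj₂ z }) c })))

  InSome : List VS → V → Set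
  InSome [] v = ⊥
  InSome (K ∷ L) v = K ∋ v ⊎ InSome L v

  Off : VS → VS → Set
  Off K L = ∀ {x} → K ∋ x → L ∋ x → ⊥

  some-off : ∀ K L → All (Off K) L → ∀ {v} → K ∋ v → InSome L v → ⊥
  some-off K (M ∷ L) (o ∷ os) p (inj₁ q) = o p q
  some-off K (M ∷ L) (o ∷ os) p (inj₂ q) = some-off K L os p q

  some-S : ∀ L → All (_⊑ S) L → ∀ {v} → InSome L v → v ∉ bs
  some-S (M ∷ L) (s ∷ ss) (inj₁ q) = proj₂ (s q)
  some-S (M ∷ L) (s ∷ ss) (inj₂ q) = some-S L ss q

  -- Greedy choice: the cycle through each big set uses at most one vertex of bs, and each big set has k candidates.
  big-pack : ∀ j L (F : List V) → j ≤ length L → length F + j ≤ k → AllPairs Off L → All (_⊑ S) L → All Big L →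
    Pack j (λ v → (v ∈ bs × v ∉ F) ⊎ InSome L v)
  big-pack zero L F _ _ _ _ _ = tt
  big-pack (suc j) (K ∷ L) F (s≤s le) lk (o ∷ os) (s ∷ ss) (b ∷ bb) with F.any? (λ x → mem? (good K) x ×-dec ¬? (x ∈? F))
  ... | no none = contradiction (≤-trans b (cnt-list (good K) F (λ {v} p → case v ∈? F of λ { (yes m) → m ; (no m) → contradiction (v , p , m) none })))
          (<⇒≱ (≤-trans (≤-trans (≤-reflexive (+-comm 1 (length F))) (+-monoʳ-≤ (length F) (s≤s z≤n))) lk))
  ... | yes (x , (xb , l , lc , w) , xF) = l , lc
    , All.map (λ { (inj₁ p) → inj₂ (inj₁ p) ; (inj₂ refl) → inj₁ (xb , xF) }) w
    , pack-mono j shrink (big-pack j L (x ∷ F) le (≤-trans (≤-reflexive (symm (+-suc (length F) j))) lk) os ss bb)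
    where
    shrink : ∀ {v} → (v ∈ bs × v ∉ x ∷ F) ⊎ InSome L v → ((v ∈ bs × v ∉ F) ⊎ (K ∋ v ⊎ InSome L v)) × v ∉ l
    shrink (inj₁ (vb , vF)) = inj₁ (vb , λ z → vF (there z)) , λ m → case All.lookup w m of λ
      { (inj₁ p) → proj₂ (s p) vb ; (inj₂ refl) → vF (here refl) }
    shrink (inj₂ q) = inj₂ (inj₂ q) , λ m → case All.lookup w m of λ
      { (inj₁ p) → some-off K L o p q ; (inj₂ refl) → some-S L ss q xb }

  all-⊑ : ∀ A B L → A ⊑ B → All (_⊑ A) L → All (_⊑ B) L
  all-⊑ A B [] s [] = []
  all-⊑ A B (K ∷ L) s (i ∷ is) = (λ z → s (i z)) ∷ all-⊑ A B L s is

  all-off : ∀ A K L → Off K A → All (_⊑ A) L → All (Off K) L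
  all-off A K [] o [] = []
  all-off A K (M ∷ L) o (i ∷ is) = (λ p q → o p (i q)) ∷ all-off A K L o is

  -- The vertices deleted per cut: the root, at most t touched ancestors, and for an ear two windows
  -- of at most 2t vertices.
  cost : ℕ
  cost = suc t + ((t + t) + (t + t))

  -- U covers the interiors of the ears and the big sets found so far, and X the windows around the
  -- ends of the ears. An ear with ends outside X and interior outside U is therefore apart from all
  -- earlier ones.
  record St : Set₁ where
    field
      X    : List V
      U    : VS
      ears : List BEar
      bigs : List VS
      ears-apart : AllPairs Apart ears
      ears-U : All (λ e → All (U ∋_) (mid e)) ears
      ears-X : All (λ e → ∀ w → w ∈ bs → (Near (u e) w → w ∈ X) × (Near (v e) w → w ∈ X)) ears
      bigs-apart : AllPairs Off bigs
      bigs-U : All (_⊑ U) bigs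
      bigs-S : All (_⊑ S) bigs
      bigs-big : All Big bigs
      size : length X ≤ cost * (length ears + length bigs)
  open St

  Grows : St → List V → VS → Set₁
  Grows σ extra R = Σ St λ σ′ → (∀ {v} → v ∈ X σ → v ∈ X σ′) × (∀ {v} → v ∈ extra → v ∈ X σ′) × (∀ {v} → U σ′ ∋ v → U σ ∋ v ⊎ R ∋ v)

  addEar : ∀ σ (e : BEar) extra R → length extra ≤ suc t → (∀ {v} → R ∋ v → ¬ (U σ ∋ v)) → All (R ∋_) (mid e) →
    u e ∉ X σ → v e ∉ X σ → Σ (Grows σ extra R) λ g → (u e ∈ X (proj₁ g))
  addEar σ e extra R le fr inR un vn = (record
    { X = X′ ; U = U σ ∪ R ; ears = e ∷ ears σ ; bigs = bigs σ
    ; ears-apart = All.tabulate apart ∷ ears-apart σ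
    ; ears-U = All.map inj₂ inR ∷ All.map (All.map inj₁) (ears-U σ)
    ; ears-X = (λ _ m → (λ z → ∈-++⁺ʳ extra (∈-++⁺ˡ (near-window m z))) , λ z → ∈-++⁺ʳ extra (∈-++⁺ʳ (window (u e)) (∈-++⁺ˡ (near-window m z))))
               ∷ All.map (λ f w m → (λ z → old (proj₁ (f w m) z)) , λ z → old (proj₂ (f w m) z)) (ears-X σ)
    ; bigs-apart = bigs-apart σ ; bigs-U = all-⊑ (U σ) (U σ ∪ R) (bigs σ) inj₁ (bigs-U σ) ; bigs-S = bigs-S σ ; bigs-big = bigs-big σ
    ; size = bound } , old , (λ m → ∈-++⁺ˡ m) , id) , ∈-++⁺ʳ extra (∈-++⁺ˡ (near-window (u∈ e) (near-refl 3≤t (u e))))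
    where
    X′ = extra ++ window (u e) ++ window (v e) ++ X σ
    old : ∀ {v} → v ∈ X σ → v ∈ X′
    old m = ∈-++⁺ʳ extra (∈-++⁺ʳ (window (u e)) (∈-++⁺ʳ (window (v e)) m))
    apart : ∀ {f} → f ∈ ears σ → Apart e f
    apart {f} m with All.lookup (ears-X σ) m
    ... | g = (λ a b → fr (All.lookup inR a) (All.lookup (All.lookup (ears-U σ) m) b)) ,
      ((λ z → un (proj₁ (g _ (u∈ e)) (near-sym z))) , λ z → un (proj₂ (g _ (u∈ e)) (near-sym z))) ,
      ((λ z → vn (proj₁ (g _ (v∈ e)) (near-sym z))) , λ z → vn (proj₂ (g _ (v∈ e)) (near-sym z)))
    bound : length X′ ≤ cost * suc (length (ears σ) + length (bigs σ))
    bound = begin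
      length X′ ≡⟨ length-++ extra ⟩
      length extra + length (window (u e) ++ window (v e) ++ X σ) ≡⟨ cong (length extra +_) (trans (length-++ (window (u e))) (cong (length (window (u e)) +_) (length-++ (window (v e))))) ⟩
      length extra + (length (window (u e)) + (length (window (v e)) + length (X σ)))
        ≤⟨ +-mono-≤ le (+-mono-≤ (length-window (u e)) (+-mono-≤ (length-window (v e)) (size σ))) ⟩
      suc t + ((t + t) + ((t + t) + cost * _)) ≡⟨ cong (suc t +_) (symm (+-assoc (t + t) (t + t) _)) ⟩
      suc t + ((t + t) + (t + t) + cost * _) ≡⟨ symm (+-assoc (suc t) ((t + t) + (t + t)) _) ⟩
      cost + cost * _ ≡⟨ symm (*-suc cost _) ⟩
      cost * suc (length (ears σ) + length (bigs σ)) ∎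
      where open ≤-Reasoning

  addBig : ∀ σ extra R → length extra ≤ suc t → R ⊑ S → (∀ {v} → R ∋ v → ¬ (U σ ∋ v)) → Big R → Grows σ extra R
  addBig σ extra R le s fr big = record
    { X = extra ++ X σ ; U = U σ ∪ R ; ears = ears σ ; bigs = R ∷ bigs σ
    ; ears-apart = ears-apart σ ; ears-U = All.map (All.map inj₁) (ears-U σ)
    ; ears-X = All.map (λ f w m → (λ z → ∈-++⁺ʳ extra (proj₁ (f w m) z)) , λ z → ∈-++⁺ʳ extra (proj₂ (f w m) z)) (ears-X σ)
    ; bigs-apart = all-off (U σ) R (bigs σ) fr (bigs-U σ) ∷ bigs-apart σ
    ; bigs-U = inj₂ ∷ all-⊑ (U σ) (U σ ∪ R) (bigs σ) inj₁ (bigs-U σ) ; bigs-S = s ∷ bigs-S σ ; bigs-big = big ∷ bigs-big σ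
    ; size = begin
        length (extra ++ X σ) ≡⟨ length-++ extra ⟩
        length extra + length (X σ) ≤⟨ +-mono-≤ (≤-trans le (m≤m+n (suc t) _)) (size σ) ⟩
        cost + cost * (length (ears σ) + length (bigs σ)) ≡⟨ symm (*-suc cost _) ⟩
        cost * suc (length (ears σ) + length (bigs σ)) ≡⟨ cong (cost *_) (symm (+-suc (length (ears σ)) _)) ⟩
        cost * (length (ears σ) + suc (length (bigs σ))) ∎
    } , ∈-++⁺ʳ extra , ∈-++⁺ˡ , id
    where open ≤-Reasoning

  hit : ∀ σ extra R → length extra ≤ suc t → Conn R → R ⊑ S → (∀ {v} → R ∋ v → ¬ (U σ ∋ v)) → Bad (X σ) R → Grows σ extra R
  hit σ extra R le cn s fr (inj₂ big) = addBig σ extra R le s fr big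
  hit σ extra R le cn s fr (inj₁ (u , v , ((ub , un) , (vb , vn)) , ((a , ra , au) , (b , rb , bv)) , nn)) with toSimple (cn ra rb)
  ... | simple l p uq w = proj₁ (addEar σ (record
    { u = u ; v = v ; u∈ = ub ; v∈ = vb ; conn = via (adj-sym au) p bv ; mid-uniq = uq ; off = All.map (λ z → proj₂ (s z)) w ; far = nn })
    extra R le fr w un vn)

  -- Bottom-up along the search tree: R is the part of K still attached to its parent, and K ∖ R has been cut off.
  record Res (as : List V) (σ : St) (K : VS) : Set₁ where
    field
      σ′   : St
      R    : VS
      R⊑K  : R ⊑ K
      more : ∀ {v} → v ∈ X σ → v ∈ X σ′
      used : ∀ {v} → U σ′ ∋ v → U σ ∋ v ⊎ (K ∋ v × ¬ (R ∋ v))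
      hook : ∀ {v} → R ∋ v → Σ V λ d → Walk R v d × AdjHead d as
      shut : ∀ {a b} → K ∋ a → ¬ (R ∋ a) → a ∉ X σ′ → S ∋ b → Adj G a b → b ∉ X σ′ → K ∋ b × ¬ (R ∋ b)
      fine : ∀ {C w} → C ∋ w → Conn C → C ⊑ K → (∀ {v} → C ∋ v → v ∉ X σ′) → ¬ Bad (X σ′) C

  Fresh : St → VS → Set
  Fresh σ K = ∀ {v} → K ∋ v → ¬ (U σ ∋ v)

  module _ (thin : ¬ Long S) where

    -- Components are treated in turn and their results unite: no edge of Q joins two of them, so a
    -- connected set meeting one lies inside it.
    loop : ∀ f as M (Q : VS) → Q ⊑ M → Closed M Q → cnt Q ≤ f → (∀ {C} → Comp M C → ∀ σ → Fresh σ C → Res as σ C) →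
      ∀ σ → Fresh σ Q → Res as σ Q
    loop f as M Q qm cl le act σ fr with F.any? (mem? Q)
    ... | no empty = record
      { σ′ = σ ; R = Q ; R⊑K = id ; more = id ; used = inj₁ ; hook = λ p → contradiction (_ , p) empty
      ; shut = λ p → contradiction (_ , p) empty
      ; fine = λ p _ s → contradiction (_ , s p) empty }
    loop zero as M Q qm cl le act σ fr | yes (w , p) = contradiction (≤-trans (cnt-inhabited Q p) le) λ ()
    loop (suc f) as M Q qm cl le act σ fr | yes (w , p) with component Q p
    ... | C , cc , cw = record
      { σ′ = σ′ r₂ ; R = R r₁ ∪ R r₂
      ; R⊑K = λ { (inj₁ z) → sub cc (R⊑K r₁ z) ; (inj₂ z) → proj₁ (R⊑K r₂ z) }
      ; more = λ z → more r₂ (more r₁ z)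
      ; used = λ z → case used r₂ z of λ
          { (inj₂ ((q , nc) , nr)) → inj₂ (q , λ { (inj₁ y) → nc (R⊑K r₁ y) ; (inj₂ y) → nr y })
          ; (inj₁ y) → case used r₁ y of λ
            { (inj₁ x) → inj₁ x ; (inj₂ (c , nr)) → inj₂ (sub cc c , λ { (inj₁ x) → nr x ; (inj₂ x) → proj₂ (R⊑K r₂ x) c }) } }
      ; hook = λ { (inj₁ z) → let d , wk , h = hook r₁ z in d , walk-mono inj₁ wk , h
                 ; (inj₂ z) → let d , wk , h = hook r₂ z in d , walk-mono inj₂ wk , h }
      ; shut = shut′ ; fine = fine′ }
      where
      open Res
      cm : Comp M C
      cm = record { sub = λ z → qm (sub cc z) ; point = w ; point∈ = cw ; conn = conn cc
                  ; clos = λ a b e → clos cc a (cl (sub cc a) b e) e }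
      r₁ = act cm σ (λ z → fr (sub cc z))
      r₂ = loop f as M (Q ∖ C) (λ z → qm (proj₁ z)) (λ { (a , na) b e → cl a b e , λ z → na (clos cc z a (adj-sym e)) })
             (≤-pred (≤-trans (cnt-strict (Q ∖ C) Q proj₁ p (λ z → proj₂ z cw)) le)) act (σ′ r₁)
             (λ { (q , nc) z → case used r₁ z of λ { (inj₁ y) → fr q y ; (inj₂ (c , _)) → nc c } })
      shut′ : ∀ {a b} → Q ∋ a → ¬ ((R r₁ ∪ R r₂) ∋ a) → a ∉ X (σ′ r₂) → S ∋ b → Adj G a b → b ∉ X (σ′ r₂) → Q ∋ b × ¬ ((R r₁ ∪ R r₂) ∋ b)
      shut′ {a} {b} q nr na sb e nb with mem? C a
      ... | yes c = let cb , nrb = shut r₁ c (λ z → nr (inj₁ z)) (λ z → na (more r₂ z)) sb e (λ z → nb (more r₂ z)) in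
              sub cc cb , λ { (inj₁ z) → nrb z ; (inj₂ z) → proj₂ (R⊑K r₂ z) cb }
      ... | no nc = let (qb , ncb) , nrb = shut r₂ (q , nc) (λ z → nr (inj₂ z)) na sb e nb in
              qb , λ { (inj₁ z) → ncb (R⊑K r₁ z) ; (inj₂ z) → nrb z }
      fine′ : ∀ {L w} → L ∋ w → Conn L → L ⊑ Q → (∀ {v} → L ∋ v → v ∉ X (σ′ r₂)) → ¬ Bad (X (σ′ r₂)) L
      fine′ {L} lw cn s nx bad with some L (mem? C)
      ... | yes (a , la , ca) = fine r₁ la cn (λ z → walk-closed (λ x _ l e → clos cc x (s l) e) ca (cn la z)) (λ l z → nx l (more r₂ z))
              (bad-mono L L (more r₂) id bad)
      ... | no none = fine r₂ lw cn (λ {v} z → s z , λ c → none (v , z , c)) nx bad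

    ex : ∀ f {K as} (sp : Sp K as) → cnt K ≤ f → ∀ σ → Fresh σ K → Res as σ K
    ex zero sp le σ fr = contradiction (≤-trans (cnt-inhabited _ (proj₁ (proj₂ (pick sp)))) le) λ ()
    ex (suc f) {K} {as} sp le σ fr with pick sp
    ... | c , p , h = decide (bad? (X (σ′ r)) R₁)
      where
      open Res
      r : Res (c ∷ as) σ (K ─ c)
      r = loop (cnt (K ─ c)) (c ∷ as) (K ─ c) (K ─ c) id (λ _ b _ → b) ≤-refl
            (λ {C} cc → ex f (down sp c p h cc) (≤-pred (≤-trans (cnt-strict C K (λ z → proj₁ (sub cc z)) p (λ z → proj₂ (sub cc z) refl)) le)))
            σ (λ z → fr (proj₁ z))
      R₁ : VS
      R₁ = R r ∪ ⟨ c ⟩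
      R₁⊑K : R₁ ⊑ K
      R₁⊑K (inj₁ z) = proj₁ (R⊑K r z)
      R₁⊑K (inj₂ refl) = p
      toC : ∀ {v} → R₁ ∋ v → Walk R₁ v c
      toC (inj₁ z) = let d , wk , a = hook r z in snoc (walk-mono inj₁ wk) a (inj₂ refl)
      toC (inj₂ refl) = [] (inj₂ refl)
      decide : Dec (Bad (X (σ′ r)) R₁) → Res as σ K
      decide (no ok) = record
        { σ′ = σ′ r ; R = R₁ ; R⊑K = R₁⊑K ; more = more r
        ; used = λ z → case used r z of λ { (inj₁ y) → inj₁ y ; (inj₂ ((k , ne) , nr)) → inj₂ (k , λ { (inj₁ x) → nr x ; (inj₂ x) → ne x }) }
        ; hook = λ z → c , toC z , h
        ; shut = λ {a} k nr na sb e nb → let (kb , ne) , nrb = shut r (k , λ z → nr (inj₂ z)) (λ z → nr (inj₁ z)) na sb e nb in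
            kb , λ { (inj₁ z) → nrb z ; (inj₂ z) → ne z }
        ; fine = fine′ }
        where
        fine′ : ∀ {L w} → L ∋ w → Conn L → L ⊑ K → (∀ {v} → L ∋ v → v ∉ X (σ′ r)) → ¬ Bad (X (σ′ r)) L
        fine′ {L} lw cn s nx bad with some L (λ v → ¬? (mem? R₁ v))
        ... | no all-R = ok (bad-mono L R₁ id (λ {v} l → case mem? R₁ v of λ { (yes z) → z ; (no z) → contradiction (v , l , z) all-R }) bad)
        -- By `shut`, no edge avoiding X leads from the part already cut off into R₁, so L lies
        -- entirely in the former.
        ... | yes (a , la , na) = fine r la cn (λ l → proj₁ (walk-closed {P = λ v → (K ─ c) ∋ v × ¬ (R r ∋ v)}
                (λ { (x , y) l₁ l₂ e → shut r x y (nx l₁) (sp-sub sp (s l₂)) e (nx l₂) })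
                ((s la , λ z → na (inj₂ z)) , λ z → na (inj₁ z)) (cn la l))) nx bad
      -- Deleting c and the at most t ancestors that K touches separates K from the rest of S, so
      -- nothing of K stays attached.
      decide (yes bad) with hit (σ′ r) (c ∷ filter (touch? K) as) R₁ (s≤s (few-touched thin sp)) (conn-from (λ z → walk-sym (toC z)))
                              (λ z → sp-sub sp (R₁⊑K z)) fresh₁ bad
        where
        fresh₁ : ∀ {v} → R₁ ∋ v → ¬ (U (σ′ r) ∋ v)
        fresh₁ z y with used r y
        ... | inj₁ x = fr (R₁⊑K z) x
        fresh₁ (inj₁ z) y | inj₂ (_ , nr) = nr z
        fresh₁ (inj₂ refl) y | inj₂ ((_ , ne) , _) = ne refl
      ... | σ₂ , keep , extra , grow = record
        { σ′ = σ₂ ; R = vs (λ _ → ⊥) (λ _ → no λ ()) ; R⊑K = λ () ; more = λ z → keep (more r z)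
        ; used = λ z → case grow z of λ
            { (inj₁ y) → case used r y of λ { (inj₁ x) → inj₁ x ; (inj₂ ((k , _) , _)) → inj₂ (k , λ ()) }
            ; (inj₂ y) → inj₂ (R₁⊑K y , λ ()) }
        ; hook = λ ()
        ; shut = λ {a} {b} k _ _ sb e nb → case sp-out sp k sb e of λ
            { (inj₁ z) → z , λ () ; (inj₂ m) → contradiction (extra (there (∈-filter⁺ (touch? K) m (a , k , e)))) nb }
        ; fine = λ {C} lw cn s nx bd → fine r lw cn (λ {v} l → s l , λ { refl → nx l (extra (here refl)) }) (λ l z → nx l (keep z)) (bad-mono C C keep id bd) }

    Chord : List V → V × V → Set
    Chord X (u , v) = (Free X u × Free X v) × (Adj G u v × ¬ Near u v)

    chord? : ∀ X p → Dec (Chord X p)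
    chord? X (u , v) = (((u ∈? bs) ×-dec ¬? (u ∈? X)) ×-dec ((v ∈? bs) ×-dec ¬? (v ∈? X))) ×-dec (adj? u v ×-dec ¬? (near? u v))

    ∅ : VS
    ∅ = vs (λ _ → ⊥) (λ _ → no λ ())

    -- Edges between far vertices of the base are ears with empty interior. Treating them before the
    -- search leaves U empty, and putting an end of each into X destroys it.
    chords : ∀ ps → Σ St λ σ → (∀ {v} → ¬ (U σ ∋ v)) × (∀ {p} → p ∈ ps → ¬ Chord (X σ) p)
    chords [] = record
      { X = [] ; U = ∅ ; ears = [] ; bigs = [] ; ears-apart = [] ; ears-U = [] ; ears-X = [] ; bigs-apart = [] ; bigs-U = []
      ; bigs-S = [] ; bigs-big = [] ; size = z≤n } , (λ ()) , λ ()
    chords ((u , v) ∷ ps) with chords ps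
    ... | σ , em , nc with chord? (X σ) (u , v)
    ... | no n = σ , em , λ { (here refl) → n ; (there m) → nc m }
    ... | yes (((ub , un) , (vb , vn)) , (a , nn)) with addEar σ (record
            { u = u ; v = v ; u∈ = ub ; v∈ = vb ; conn = chord a ; mid-uniq = [] ; off = [] ; far = nn }) [] ∅ z≤n (λ ()) [] un vn
    ... | (σ₂ , keep , _ , grow) , uX = σ₂ , (λ z → case grow z of λ { (inj₁ y) → em y }) , λ
            { (here refl) (((_ , n) , _) , _) → n uX
            ; (there m) (((x , y) , (z , w)) , r) → nc m (((x , λ q → y (keep q)) , (z , λ q → w (keep q))) , r) }

    record Extract : Set₁ where
      field
        X     : List V
        small : length X ≤ cost * (600 * (k * k) + k)
        fine  : ∀ {C w} → C ∋ w → Conn C → C ⊑ S → (∀ {v} → C ∋ v → v ∉ X) → ¬ Bad X C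
        local : ∀ {u v} → Free X u → Free X v → Adj G u v → Near u v

    extract : 1 ≤ k → ∀ {b} → Pieces b bs → b ≤ k → ¬ Pack k (λ _ → ⊤) → Extract
    extract 1≤k ps b≤k np with chords (cartesianProduct (allFin n) (allFin n))
    ... | σ₀ , em , nc = record
      { X = X σ
      ; small = ≤-trans (size σ) (*-monoʳ-≤ cost (+-mono-≤ few-ears few-bigs))
      ; fine = fine r
      ; local = λ {u} {v} fu fv a → case near? u v of λ
          { (yes y) → y
          ; (no y) → contradiction (((proj₁ fu , λ z → proj₂ fu (more r z)) , (proj₁ fv , λ z → proj₂ fv (more r z))) , (a , y))
              (nc (∈-cartesianProduct⁺ (∈-allFin u) (∈-allFin v))) } }
      where
      open Res
      r : Res [] σ₀ S
      r = loop (cnt S) [] S S id (λ _ b _ → b) ≤-refl (λ {C} cc → ex (cnt C) (root cc) ≤-refl) σ₀ (λ _ → em)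
      σ = σ′ r
      few-ears : length (ears σ) ≤ 600 * (k * k)
      few-ears with 600 * (k * k) ≤? length (ears σ)
      ... | yes le = contradiction (ears-pack k 1≤k ps b≤k (ears σ) (ears-apart σ) le) np
      ... | no nle = <⇒≤ (≰⇒> nle)
      few-bigs : length (bigs σ) ≤ k
      few-bigs with k ≤? length (bigs σ)
      ... | yes le = contradiction (pack-mono k (λ _ → tt) (big-pack k (bigs σ) [] le ≤-refl (bigs-apart σ) (bigs-S σ) (bigs-big σ))) np
      ... | no nle = <⇒≤ (≰⇒> nle)

-- The layout of the whole graph along the base.

module Global {n : ℕ} (G : Graph n) (t : ℕ) (3≤t : 3 ≤ t) (k : ℕ) (W : ℕ) (connected : KConnected (k + 1) G)
  (bs : List (Fin n)) (bs-uniq : Unique bs) (thin : ¬ Cycles.Long G t 3≤t (Extraction.S G t 3≤t bs bs-uniq k))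
  (extracted : Extraction.Extract G t 3≤t bs bs-uniq k thin) where

  open Extraction G t 3≤t bs bs-uniq k
  open Extract extracted
  open Layouts G W using (Ext; done; add; _▷_; ext-to; Bd)

  idx-< : ∀ l {v} → v ∈ l → idx l v < length l
  idx-< (x ∷ l) {v} m with x F.≟ v
  ... | yes _ = s≤s z≤n
  idx-< (x ∷ l) (here refl) | no ne = contradiction refl ne
  idx-< (x ∷ l) (there m) | no ne = s≤s (idx-< l m)

  idx-injective : ∀ l {v w} → v ∈ l → w ∈ l → idx l v ≡ idx l w → v ≡ w
  idx-injective (x ∷ l) {v} {w} mv mw e with x F.≟ v | x F.≟ w
  ... | yes refl | yes refl = refl
  idx-injective (x ∷ l) mv mw () | yes _ | no _
  idx-injective (x ∷ l) mv mw () | no _ | yes _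
  idx-injective (x ∷ l) (here refl) _ e | no ne | no _ = contradiction refl ne
  idx-injective (x ∷ l) (there _) (here refl) e | no _ | no ne = contradiction refl ne
  idx-injective (x ∷ l) (there mv) (there mw) e | no _ | no _ = idx-injective l mv mw (suc-injective e)

  at-index : ∀ l i → i < length l → Unique l → ∃ λ v → v ∈ l × idx l v ≡ i
  at-index (x ∷ l) zero _ u = x , here refl , idx-split [] u
  at-index (x ∷ l) (suc i) (s≤s lt) (ne ∷ u) with at-index l i lt u
  ... | v , m , e with x F.≟ v
  ...   | yes refl = contradiction refl (All.lookup ne m)
  ...   | no x≢v = v , there m , trans (skip x≢v) (cong suc e)
    where
    skip : x ≢ v → idx (x ∷ l) v ≡ suc (idx l v)
    skip ne with x F.≟ v
    ... | yes e = contradiction e ne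
    ... | no _ = refl

  S′ : VS
  S′ = S ∖ lst X

  -- The state when X and the first i vertices of the base are placed, with components of the rest
  -- either finished or untouched. Apart from X, only the last t base vertices can have unplaced
  -- neighbours, which bounds the held list.
  record Stage (i : ℕ) (P : VS) : Set where
    field
      x-in   : ∀ {v} → v ∈ X → P ∋ v
      b-in   : ∀ {v} → v ∈ bs → idx bs v < i → P ∋ v
      b-out  : ∀ {v} → v ∈ bs → P ∋ v → v ∈ X ⊎ idx bs v < i
      s-done : ∀ {a b} → S′ ∋ a → P ∋ a → ¬ (P ∋ b) → ¬ Adj G a b
      recent : ∀ {p q} → Free X p → P ∋ p → ¬ (P ∋ q) → Adj G p q → i ≤ idx bs p + t
  open Stage

  held : ℕ → List V
  held i = X ++ take t (drop (i ∸ t) bs)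

  length-held : ∀ i → length (held i) ≤ length X + t
  length-held i = ≤-trans (≤-reflexive (length-++ X)) (+-monoʳ-≤ (length X)
    (≤-trans (≤-reflexive (length-take t (drop (i ∸ t) bs))) (m⊓n≤m _ _)))

  held-bd : ∀ {i P} → Stage i P → Bd P (held i)
  held-bd {i} st {p} {q} pp nq a with p ∈? X | p ∈? bs
  ... | yes m | _ = ∈-++⁺ˡ m
  ... | no nx | no nb = contradiction a (s-done st ((tt , nb) , nx) pp nq)
  ... | no nx | yes m with b-out st m pp
  ...   | inj₁ x = contradiction x nx
  ...   | inj₂ lt = ∈-++⁺ʳ X (∈-window bs (i ∸ t) t m
            (≤-trans (∸-monoˡ-≤ t (recent st (m , nx) pp nq a)) (≤-reflexive (m+n∸n≡m (idx bs p) t)))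
            (≤-trans lt (≤-trans (m≤n+m∸n i t) (≤-reflexive (+-comm t (i ∸ t))))))

  Blocked : VS → VS → Set
  Blocked P C = ∃ λ b → Touch C b × ¬ (C ∋ b) × ¬ (P ∋ b)

  blocked? : ∀ P C → Dec (Blocked P C)
  blocked? P C = F.any? (λ b → touch? C b ×-dec (¬? (mem? C b) ×-dec ¬? (mem? P b)))

  AllBlocked : VS → Set₁
  AllBlocked P = ∀ {C w} → Comp S′ C → C ∋ w → ¬ (P ∋ w) → Blocked P C

  Ready : VS → V → Set₁
  Ready P w = Σ VS λ C → Comp S′ C × C ∋ w × ¬ (P ∋ w) × ¬ Blocked P C

  ready? : ∀ P w → Dec (Ready P w)
  ready? P w with mem? S′ w | mem? P w
  ... | no ns | _ = no λ { (C , cc , cw , _) → ns (sub cc cw) }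
  ... | yes _ | yes p = no λ { (_ , _ , _ , np , _) → np p }
  ... | yes s | no np with component S′ s
  ... | C , cc , cw with blocked? P C
  ...   | no nb = yes (C , cc , cw , np , nb)
  ...   | yes (b , (a , ca , e) , nc , nb) = no λ { (D , dc , dw , _ , nbl) → nbl (b ,
            (a , comp-walk dc dw (walk-mono (sub cc) (conn cc cw ca)) , e) ,
            (λ d → nc (comp-walk cc cw (walk-mono (sub dc) (conn dc dw d)))) , nb) }

  unready : ∀ P → ¬ ∃ (Ready P) → AllBlocked P
  unready P nr {C} {w} cc cw np with blocked? P C
  ... | yes b = b
  ... | no nb = contradiction (w , C , cc , cw , np , nb) nr

  module _ (e : ℕ) (room₁ : length X + t < 2 ^ suc e)
    (room₂ : length X + t + (suc (t * t) + suc (t * t + t)) * suc e ≤ W) where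

    -- Here Z consists of the base vertices with a long cycle through C, fewer than k because C is
    -- not `Big`. A vertex off the base closes no long cycle with C, since S contains none.
    lay : ∀ {i P C w} → Stage i P → Comp S′ C → C ∋ w → ¬ (P ∋ w) → ¬ Blocked P C → Ext P (P ∪ C) × Stage i (P ∪ C)
    lay {i} {P} {C} {w} st cc cw np nb = LayComponent.layComponent G t 3≤t W k C (els (good C)) (conn cc)
        (λ l → thin (long-mono (λ c → proj₁ (sub cc c)) l))
        (≰⇒> (λ big → ok (inj₂ big)))
        (λ m c → proj₂ (proj₁ (sub cc c)) (proj₁ (els⁻ (good C) m)))
        (λ {x} nc nz l → case x ∈? bs of λ
          { (yes m) → nz (els⁺ (good C) (m , l))
          ; (no m) → thin (long-mono (λ { (inj₁ c) → proj₁ (sub cc c) ; (inj₂ refl) → tt , m }) l) })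
        (separation k connected) e {P} {held i} fresh outer (held-bd st) (w , cw)
        (≤-trans (s≤s (length-held i)) room₁) (≤-trans (+-monoˡ-≤ _ (length-held i)) room₂)
      , record
        { x-in = λ m → inj₁ (x-in st m) ; b-in = λ m lt → inj₁ (b-in st m lt)
        ; b-out = λ { m (inj₁ p) → b-out st m p ; m (inj₂ c) → contradiction m (proj₂ (proj₁ (sub cc c))) }
        ; s-done = λ { s (inj₁ p) nq → s-done st s p (λ z → nq (inj₁ z)) ; s (inj₂ c) nq a → nq (inj₁ (outer c (λ z → nq (inj₂ z)) a)) }
        ; recent = λ { f (inj₁ p) nq → recent st f p (λ z → nq (inj₁ z)) ; f (inj₂ c) → contradiction (proj₁ f) (proj₂ (proj₁ (sub cc c))) } }
      where
      ok : ¬ Bad X C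
      ok = fine cw (conn cc) (λ c → proj₁ (sub cc c)) (λ c → proj₂ (sub cc c))
      fresh : ∀ {v} → C ∋ v → ¬ (P ∋ v)
      fresh c p = np (walk-closed {P = λ v → P ∋ v} (λ {a} {b} pa ca cb e → case mem? P b of λ
        { (yes z) → z ; (no z) → contradiction e (s-done st (sub cc ca) pa z) }) p (conn cc c cw))
      outer : ∀ {a b} → C ∋ a → ¬ (C ∋ b) → Adj G a b → P ∋ b
      outer {a} {b} c nc e with mem? P b
      ... | yes p = p
      ... | no np′ = contradiction (b , (a , c , e) , nc , np′) nb

    settle : ∀ f i P → cnt (all ∖ P) ≤ f → Stage i P → Σ VS λ Q → Ext P Q × Stage i Q × AllBlocked Q
    settle f i P le st with F.any? (ready? P)
    settle f i P le st | no nr = P , done id id , st , unready P nr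
    settle zero i P le st | yes (w , _ , _ , _ , np , _) = contradiction (≤-trans (cnt-inhabited (all ∖ P) {w} (tt , np)) le) λ ()
    settle (suc f) i P le st | yes (w , C , cc , cw , np , nb) with lay st cc cw np nb
    ... | ext , st′ with settle f i (P ∪ C) (≤-pred (≤-trans (cnt-strict (all ∖ (P ∪ C)) (all ∖ P) (λ { (_ , z) → tt , λ y → z (inj₁ y) }) {w} (tt , np) (λ { (_ , z) → z (inj₂ cw) })) le)) st′
    ... | Q , ext′ , rest = Q , ext ▷ ext′ , rest

    -- Let p be a placed base vertex outside X with an unplaced neighbour q. If q is on the base,
    -- `local` makes p near to it. Otherwise the component of q is blocked by an unplaced base
    -- vertex b, and p is near b since the component is not `NonLocal`. Both q and b have position
    -- at least i, so p is recent.
    advance : ∀ {i P v} → v ∈ bs → idx bs v ≡ i → Stage i P → AllBlocked P → Ext P (P ∪ ⟨ v ⟩) × Stage (suc i) (P ∪ ⟨ v ⟩)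
    advance {i} {P} {v} vb refl st blocked = ext , record
      { x-in = λ m → inj₁ (x-in st m)
      ; b-in = b-in′
      ; b-out = λ { m (inj₁ p) → case b-out st m p of λ { (inj₁ x) → inj₁ x ; (inj₂ lt) → inj₂ (m≤n⇒m≤1+n lt) } ; m (inj₂ refl) → inj₂ ≤-refl }
      ; s-done = λ { s (inj₁ p) nq → s-done st s p (λ z → nq (inj₁ z)) ; ((_ , nb) , _) (inj₂ refl) → contradiction vb nb }
      ; recent = λ { f (inj₁ p) nq a → old f p (λ z → nq (inj₁ z)) a ; f (inj₂ refl) nq a → m<m+n (idx bs v) (≤-trans (s≤s z≤n) 3≤t) } }
      where
      ext : Ext P (P ∪ ⟨ v ⟩)
      ext with mem? P v
      ... | yes p = done inj₁ λ { (inj₁ z) → z ; (inj₂ refl) → p }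
      ... | no np = add v (held i) np (held-bd st) (≤-trans (length-held i) (≤-trans (m≤m+n _ _) room₂)) (done id id)
      b-in′ : ∀ {w} → w ∈ bs → idx bs w < suc i → (P ∪ ⟨ v ⟩) ∋ w
      b-in′ {w} m lt with m≤n⇒m<n∨m≡n (≤-pred lt)
      ... | inj₁ lt′ = inj₁ (b-in st m lt′)
      ... | inj₂ eq = inj₂ (idx-injective bs m vb eq)
      later : ∀ {q} → q ∈ bs → ¬ (P ∋ q) → i ≤ idx bs q
      later m nq = ≮⇒≥ (λ lt → nq (b-in st m lt))
      old : ∀ {p q} → Free X p → P ∋ p → ¬ (P ∋ q) → Adj G p q → suc i ≤ idx bs p + t
      old {p} {q} f pp nq a with q ∈? bs
      ... | yes m = ≤-trans (s≤s (later m nq)) (proj₂ (local f (m , λ z → nq (x-in st z)) a))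
      ... | no nb with component S′ ((tt , nb) , λ z → nq (x-in st z))
      ... | C , cc , cq with blocked cc cq nq
      ... | b , (c , cb , e) , nc , nb′ with b ∈? bs
      ...   | no out = contradiction (clos cc cb ((tt , out) , λ z → nb′ (x-in st z)) e) nc
      ...   | yes m with near? p b
      ...     | yes near = ≤-trans (s≤s (later m nb′)) (proj₂ near)
      ...     | no far = contradiction (inj₁ (p , b , (f , (m , λ z → nb′ (x-in st z))) , ((q , cq , adj-sym a) , (c , cb , e)) , far))
                  (fine cq (conn cc) (λ c → proj₁ (sub cc c)) (λ c → proj₂ (sub cc c)))

    sweepAll : ∀ r i P → i + r ≡ length bs → Stage i P → Ext P all
    sweepAll r i P eq st with settle (cnt (all ∖ P)) i P ≤-refl st
    -- Once X and the whole base are placed, no component can be blocked, so every vertex is placed.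
    sweepAll zero i P eq st | Q , ext , st′ , blocked = ext-to (λ _ → tt) (λ {v} _ → full v) ext
      where
      inB : ∀ {v} → v ∈ bs → Q ∋ v
      inB m = b-in st′ m (subst (_ <_) (trans (symm eq) (+-identityʳ i)) (idx-< bs m))
      full : ∀ v → Q ∋ v
      full v with mem? Q v
      ... | yes p = p
      ... | no np with component S′ ((tt , λ m → np (inB m)) , λ m → np (x-in st′ m))
      ... | C , cc , cv with blocked cc cv np
      ... | b , (c , cb , e) , nc , nb = contradiction (clos cc cb ((tt , λ m → nb (inB m)) , λ m → nb (x-in st′ m)) e) nc
    sweepAll (suc r) i P eq st | Q , ext , st′ , blocked with at-index bs i (subst (i <_) eq (m<m+n i (s≤s z≤n))) bs-uniq
    ... | v , m , e with advance m e st′ blocked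
    ... | ext′ , st″ = ext ▷ ext′ ▷ sweepAll r (suc i) (Q ∪ ⟨ v ⟩) (trans (symm (+-suc i r)) eq) st″

    first : ∀ l P → P ⊑ lst X → (∀ {v} → v ∈ l → v ∈ X) → Ext P (P ∪ lst l)
    first [] P s r = done inj₁ λ { (inj₁ z) → z }
    first (v ∷ l) P s r with mem? P v
    ... | yes p = ext-to (λ { (inj₁ z) → inj₁ z ; (inj₂ z) → inj₂ (there z) })
                    (λ { (inj₁ z) → inj₁ z ; (inj₂ (here refl)) → inj₁ p ; (inj₂ (there z)) → inj₂ z }) (first l P s (λ z → r (there z)))
    ... | no np = add v X np (λ p _ _ → s p) (≤-trans (≤-trans (m≤m+n _ t) (m≤m+n _ _)) room₂)
                    (ext-to (λ { (inj₁ (inj₁ z)) → inj₁ z ; (inj₁ (inj₂ e)) → inj₂ (here e) ; (inj₂ z) → inj₂ (there z) })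
                            (λ { (inj₁ z) → inj₁ (inj₁ z) ; (inj₂ (here e)) → inj₁ (inj₂ e) ; (inj₂ (there z)) → inj₂ z })
                            (first l (P ∪ ⟨ v ⟩) (λ { (inj₁ z) → s z ; (inj₂ refl) → r (here refl) }) (λ z → r (there z))))

    pathwidth-bound : PathwidthAtMost G W
    pathwidth-bound = Layouts.decomposition G W (first X nothing (λ ()) id ▷ sweepAll (length bs) 0 (nothing ∪ lst X) refl record
      { x-in = inj₂ ; b-in = λ _ () ; b-out = λ { _ (inj₂ x) → inj₁ x } ; s-done = λ { (_ , nx) (inj₂ x) → contradiction x nx }
      ; recent = λ { (_ , nx) (inj₂ x) → contradiction x nx } }) (λ ()) tt
      where
      nothing : VS
      nothing = vs (λ _ → ⊥) (λ _ → no λ ())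

-- Numerical estimates.

module Bounds where

  n<2^n : ∀ m → m < 2 ^ m
  n<2^n zero = s≤s z≤n
  n<2^n (suc m) = ≤-trans (s≤s (n<2^n m)) (+-mono-≤ (≤-trans (s≤s z≤n) (n<2^n m)) (≤-reflexive (symm (+-identityʳ (2 ^ m)))))

  product-≤ : ∀ x y → x * y ≤ x * x + y * y
  product-≤ x y with ≤-total x y
  ... | inj₁ le = ≤-trans (*-monoˡ-≤ y le) (m≤n+m (y * y) (x * x))
  ... | inj₂ le = ≤-trans (*-monoʳ-≤ x le) (m≤m+n (x * x) (y * y))

  module _ (t k : ℕ) (3≤t : 3 ≤ t) (1≤k : 1 ≤ k) where

    open ≤-Reasoning

    private
      B = t * (k * k)
      A = t * (t * t)

    1≤t : 1 ≤ t
    1≤t = ≤-trans (s≤s z≤n) 3≤t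

    1≤kk : 1 ≤ k * k
    1≤kk = *-mono-≤ 1≤k 1≤k

    -- The cost of a cut is at most 6t and there are at most 601k² cuts; the summand t adds one more
    -- tk², giving 6 · 601 + 1 = 3607.
    apex-bound : ∀ {x} → x ≤ (suc t + ((t + t) + (t + t))) * (600 * (k * k) + k) → x + t ≤ 3607 * B
    apex-bound {x} le = begin
      x + t ≤⟨ +-monoˡ-≤ t le ⟩
      (suc t + ((t + t) + (t + t))) * (600 * (k * k) + k) + t
        ≤⟨ +-mono-≤ (*-mono-≤ (+-monoˡ-≤ ((t + t) + (t + t)) (+-monoˡ-≤ t 1≤t)) (+-monoʳ-≤ (600 * (k * k)) (≤-trans (≤-reflexive (symm (*-identityʳ k))) (*-monoʳ-≤ k 1≤k))))
             (≤-trans (≤-reflexive (symm (*-identityʳ t))) (*-monoʳ-≤ t 1≤kk)) ⟩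
      (t + t + ((t + t) + (t + t))) * (600 * (k * k) + k * k) + B ≡⟨ eq t (k * k) ⟩
      3607 * B ∎
      where
      eq : ∀ t z → (t + t + ((t + t) + (t + t))) * (600 * z + z) + t * z ≡ 3607 * (t * z)
      eq = solve-∀

    -- A linear bound for the logarithm of 3607tk²: the factors are at most 2 ^ 12, 2 ^ t and 2 ^
    -- (2k), and one is subtracted since `suc level` is the exponent used.
    level : ℕ
    level = 11 + (t + (k + k))

    level-bound : ∀ {x} → x ≤ 3607 * B → x < 2 ^ suc level
    level-bound {x} le = begin-strict
      x ≤⟨ le ⟩
      3607 * B ≤⟨ *-mono-≤ {3607} {2 ^ 12} (m≤m+n 3607 489) (*-monoʳ-≤ t (*-mono-≤ (<⇒≤ (n<2^n k)) (<⇒≤ (n<2^n k)))) ⟩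
      2 ^ 12 * (t * (2 ^ k * 2 ^ k)) <⟨ *-monoʳ-< (2 ^ 12) (*-monoˡ-< (2 ^ k * 2 ^ k) {{m*n≢0 (2 ^ k) (2 ^ k) {{m^n≢0 2 k}} {{m^n≢0 2 k}}}} (n<2^n t)) ⟩
      2 ^ 12 * (2 ^ t * (2 ^ k * 2 ^ k)) ≡⟨ cong (λ z → 2 ^ 12 * (2 ^ t * z)) (symm (^-distribˡ-+-* 2 k k)) ⟩
      2 ^ 12 * (2 ^ t * 2 ^ (k + k)) ≡⟨ cong (2 ^ 12 *_) (symm (^-distribˡ-+-* 2 t (k + k))) ⟩
      2 ^ 12 * 2 ^ (t + (k + k)) ≡⟨ symm (^-distribˡ-+-* 2 12 (t + (k + k))) ⟩
      2 ^ suc level ∎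

    -- The price per halving is at most 4t², and 12 ≤ 4t bounds the number of halvings by 5t + 2k.
    -- The mixed term t²k is absorbed through tk ≤ t² + k².
    levels-bound : (suc (t * t) + suc (t * t + t)) * suc level ≤ 28 * A + 8 * B
    levels-bound = begin
      (suc (t * t) + suc (t * t + t)) * suc level
        ≤⟨ *-mono-≤ {suc (t * t) + suc (t * t + t)} {4 * (t * t)} side (+-monoˡ-≤ (t + (k + k)) (*-monoʳ-≤ 4 3≤t)) ⟩
      4 * (t * t) * (4 * t + (t + (k + k))) ≡⟨ eq t k ⟩
      20 * A + 8 * (t * (t * k)) ≤⟨ +-monoʳ-≤ (20 * A) (*-monoʳ-≤ 8 (*-monoʳ-≤ t (product-≤ t k))) ⟩
      20 * A + 8 * (t * (t * t + k * k)) ≡⟨ eq₂ t (t * t) (k * k) ⟩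
      28 * A + 8 * B ∎
      where
      eq : ∀ t k → 4 * (t * t) * (4 * t + (t + (k + k))) ≡ 20 * (t * (t * t)) + 8 * (t * (t * k))
      eq = solve-∀
      eq₂ : ∀ t x y → 20 * (t * x) + 8 * (t * (x + y)) ≡ 28 * (t * x) + 8 * (t * y)
      eq₂ = solve-∀
      eq₃ : ∀ x t → suc x + suc (x + t) ≡ x + x + (t + 2)
      eq₃ = solve-∀
      eq₄ : ∀ x → x + x + (x + x) ≡ 4 * x
      eq₄ = solve-∀
      side : suc (t * t) + suc (t * t + t) ≤ 4 * (t * t)
      side = begin
        suc (t * t) + suc (t * t + t) ≡⟨ eq₃ (t * t) t ⟩
        t * t + t * t + (t + 2) ≤⟨ +-monoʳ-≤ (t * t + t * t) (+-mono-≤ (≤-trans (≤-reflexive (symm (*-identityʳ t))) (*-monoʳ-≤ t 1≤t))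
          (≤-trans (s≤s (s≤s z≤n)) (*-mono-≤ {3} {t} {1} {t} 3≤t 1≤t))) ⟩
        t * t + t * t + (t * t + t * t) ≡⟨ eq₄ (t * t) ⟩
        4 * (t * t) ∎

    total-bound : ∀ {x} → x ≤ 3607 * B → x + (suc (t * t) + suc (t * t + t)) * suc level ≤ 3615 * (A + B)
    total-bound {x} le = begin
      x + (suc (t * t) + suc (t * t + t)) * suc level ≤⟨ +-mono-≤ le levels-bound ⟩
      3607 * B + (28 * A + 8 * B) ≤⟨ m≤m+n _ (3587 * A) ⟩
      3607 * B + (28 * A + 8 * B) + 3587 * A ≡⟨ eq A B ⟩
      3615 * (A + B) ∎
      where
      eq : ∀ x y → 3607 * y + (28 * x + 8 * y) + 3587 * x ≡ 3615 * (x + y)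
      eq = solve-∀

  -- Passing from t to 2 + t ≤ 3t costs at most a factor 3³ = 27.
  shift-bound : ∀ t k → 1 ≤ t → (2 + t) * ((2 + t) * (2 + t)) + (2 + t) * (k * k) ≤ 27 * (t ^ 3 + t * k ^ 2)
  shift-bound t k 1≤t = begin
    (2 + t) * ((2 + t) * (2 + t)) + (2 + t) * (k * k) ≤⟨ +-mono-≤ (*-mono-≤ le (*-mono-≤ le le)) (*-monoˡ-≤ (k * k) le) ⟩
    3 * t * (3 * t * (3 * t)) + 3 * t * (k * k) ≤⟨ m≤m+n _ (24 * (t * (k * k))) ⟩
    3 * t * (3 * t * (3 * t)) + 3 * t * (k * k) + 24 * (t * (k * k)) ≡⟨ eq t k ⟩
    27 * (t * (t * t) + t * (k * k)) ≡⟨ cong₂ (λ x y → 27 * (t * (t * x) + t * (k * y))) (symm (*-identityʳ t)) (symm (*-identityʳ k)) ⟩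
    27 * (t ^ 3 + t * k ^ 2) ∎
    where
    open ≤-Reasoning
    le : 2 + t ≤ 3 * t
    le = ≤-trans (+-monoˡ-≤ t (*-monoʳ-≤ 2 1≤t)) (≤-reflexive (eq₀ t))
      where
      eq₀ : ∀ t → 2 * t + t ≡ 3 * t
      eq₀ = solve-∀
    eq : ∀ t k → 3 * t * (3 * t * (3 * t)) + 3 * t * (k * k) + 24 * (t * (k * k)) ≡ 27 * (t * (t * t) + t * (k * k))
    eq = solve-∀

  scale : ∀ c z {x y} → x ≤ c * y → y ≤ 27 * z → x ≤ c * 27 * z
  scale c z p q = ≤-trans p (≤-trans (*-monoʳ-≤ c q) (≤-reflexive (symm (*-assoc c 27 z))))

-- Assembly of base, extraction and layout for the threshold t + 2.

theorem2 : Σ ℕ λ C → ∀ (k t : ℕ) → 1 ≤ k → 1 ≤ t →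
    ∀ (n : ℕ) (G : Graph n) → KConnected (k + 1) G → ¬ HasDisjointLongCycles G k t →
    PathwidthAtMost G (C * (t ^ 3 + t * k ^ 2))
-- The factor 3615 comes from `total-bound` for the threshold t + 2, and 27 from returning to t by
-- `shift-bound`.
theorem2 = 3615 * 27 , bound
  where
  bound : ∀ (k t : ℕ) → 1 ≤ k → 1 ≤ t → ∀ (n : ℕ) (G : Graph n) → KConnected (k + 1) G → ¬ HasDisjointLongCycles G k t →
    PathwidthAtMost G (3615 * 27 * (t ^ 3 + t * k ^ 2))
  bound k t 1≤k 1≤t n G conn none =
    Global.pathwidth-bound G t′ 3≤t′ k _ conn bs bs-uniq bs-hit ex (Bounds.level t′ k 3≤t′ 1≤k)
      (Bounds.level-bound t′ k 3≤t′ 1≤k apex)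
      (Bounds.scale 3615 (t ^ 3 + t * k ^ 2) (Bounds.total-bound t′ k 3≤t′ 1≤k apex) (Bounds.shift-bound t k 1≤t))
    where
    -- A closed path on at least t + 2 ≥ 3 vertices is a genuine cycle.
    t′ = 2 + t
    3≤t′ : 3 ≤ t′
    3≤t′ = s≤s (s≤s 1≤t)
    no-pack : ¬ Cycles.Pack G t′ 3≤t′ k (λ _ → ⊤)
    no-pack p = let cs , long , disjoint = Cycles.pack⇒disjoint G t′ 3≤t′ k p in
      none (cs , (λ i → ≤-trans (m≤n+m t 2) (long i)) , disjoint)
    open Bases.Base (Bases.base G t′ 3≤t′ k no-pack)
    ex = Extraction.extract G t′ 3≤t′ bs bs-uniq k bs-hit 1≤k pieces b≤k no-pack
    apex = Bounds.apex-bound t′ k 3≤t′ 1≤k (Extraction.Extract.small ex)
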